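{- Let $\varphi(x)=\sum_{i\ge0}\gamma_ix^i\in\mathbb{K}[[x]]$, let $r\in\mathbb{Z}$, and stipulate $\gamma_i=0$ for $i<0$. Then $\varphi\in\mathcal{F}_r$ if and only if the following hold. If $r=2k$ is even: for each $n\ge\max\{0,1-k\}$, $$\gamma_{2n}=\frac{2}{2n+r}\sum_{i=-k}^n\binom{2n+r}{2i+r}B_{2n-2i}\gamma_{2i+1}, \qquad (\ast)$$ and, if $r\le0$, then $\gamma_{1-r}=0$ (with no condition imposed on $\gamma_{ -r}$), and, when $r<0$, for $0\le n\le -k-1$, $$\gamma_{2n}=\sum_{i=0}^n\frac{2}{2i+r}\binom{ -2i-r}{ -2n-r}B_{2n-2i}\gamma_{2i+1}. \qquad (\ast\ast)$$ If $r=2k+1$ is odd: $(\ast)$ holds for each $n\ge\max\{0,-k\}$, and, if $r<0$, $(\ast\ast)$ holds for $0\le n\le -k-1$. In particular these conditions determine all $\gamma_{2i}$ from the $\gamma_{2i+1}$, except $\gamma_{ -r}$ when $r\le0$ is even, which is unconstrained.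
   Context: $\mathbb{K}\in\{\mathbb{Q},\mathbb{R},\mathbb{C}\}$. For $r\in\mathbb{Z}$, $\mathcal{F}_r$ denotes the space of $\varphi\in\mathbb{K}[[x]]$ with $\varphi(x/(x-1))=(1-x)^r\varphi(x)$. $B_n$ is the $n$th Bernoulli number, $\frac{t}{e^t-1}=\sum_{n\ge0}B_n\frac{t^n}{n!}$. -}

module Defs where

open import Algebra.Apartness.Bundles using (HeytingField; HeytingCommutativeRing)
open import Algebra.Bundles using (CommutativeRing)
import Algebra.Definitions.RawMonoid as RawMonoidDefs
import Algebra.Properties.Ring as RingProperties
import Algebra.Properties.Semiring.Sum as SemiringSum
open import Data.Fin.Base as Fin using (Fin; toℕ)
open import Data.Integer.Base as ℤ using (ℤ; +_; -[1+_]; +[1+_]; 0ℤ; 1ℤ; ∣_∣)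
open import Data.Nat.Base as ℕ using (ℕ; zero; suc; _∸_; _!)
open import Data.Nat.Combinatorics using (_C_)
open import Data.Nat.Properties using (_!≢0)
open import Data.Product.Base using (_×_; _,_; proj₁; proj₂)
open import Data.Vec.Base using (Vec; []; _∷_; head; lookup)
open import Level using (Level)
open import Relation.Binary.PropositionalEquality as ≡ using (_≡_; _≢_)

private
  variable
    c ℓ ℓ₁ ℓ₂ : Level

module PowerSeries (R : CommutativeRing c ℓ) where

  open CommutativeRing R
  open RingProperties ring using (-0#≈0#; -‿distribˡ-*; -‿distribʳ-*; -‿involutive)
  open SemiringSum semiring using (sum; sum-cong-≗)
  open import Relation.Binary.Reasoning.Setoid setoid

  Series : Set c
  Series = ℕ → Carrier

  infix 4 _≈ₛ_
  _≈ₛ_ : Series → Series → Set ℓ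
  f ≈ₛ g = ∀ n → f n ≈ g n

  1ₛ : Series
  1ₛ zero    = 1#
  1ₛ (suc _) = 0#

  X : Series
  X zero    = 0#
  X (suc n) = 1ₛ n

  infixl 6 _-ₛ_
  _-ₛ_ : Series → Series → Series
  (f -ₛ g) n = f n - g n

  infixl 7 _*ₛ_
  _*ₛ_ : Series → Series → Series
  (f *ₛ g) n = sum {suc n} λ i → f (toℕ i) * g (n ∸ toℕ i)

  infixr 8 _^ₛ_
  _^ₛ_ : Series → ℕ → Series
  f ^ₛ zero  = 1ₛ
  f ^ₛ suc n = f *ₛ f ^ₛ n

  -- Substitution f(g(x)).  Truncating the outer sum at n is legitimate only
  -- when g has zero constant term, so that gⁱ is divisible by xⁱ.
  infixr 9 _∘ₛ_
  _∘ₛ_ : Series → Series → Series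
  (f ∘ₛ g) n = sum {suc n} λ i → f (toℕ i) * (g ^ₛ toℕ i) n

  -- inverseCoeffs f u n = gₙ ∷ … ∷ g₀, where g = 1/f and u is the inverse of
  -- the constant term of f.
  inverseCoeffs : Series → Carrier → (n : ℕ) → Vec Carrier (suc n)
  inverseCoeffs f u zero    = u ∷ []
  inverseCoeffs f u (suc n) = - u * sum {suc n} (λ i → f (suc (toℕ i)) * lookup gs i) ∷ gs
    where
    gs : Vec Carrier (suc n)
    gs = inverseCoeffs f u n

  inverse : Series → Carrier → Series
  inverse f u n = head (inverseCoeffs f u n)

  lookup-inverseCoeffs : ∀ f u n (i : Fin (suc n)) →
                         lookup (inverseCoeffs f u n) i ≡ inverse f u (n ∸ toℕ i)
  lookup-inverseCoeffs f u zero    Fin.zero    = ≡.refl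
  lookup-inverseCoeffs f u (suc n) Fin.zero    = ≡.refl
  lookup-inverseCoeffs f u (suc n) (Fin.suc i) = lookup-inverseCoeffs f u n i

  *-inverse : ∀ f u → f 0 * u ≈ 1# → f *ₛ inverse f u ≈ₛ 1ₛ
  *-inverse f u f₀u≈1 zero    = trans (+-identityʳ _) f₀u≈1
  *-inverse f u f₀u≈1 (suc n) = begin
    f 0 * (- u * S) + S′        ≈⟨ +-congˡ (reflexive S′≡S) ⟩
    f 0 * (- u * S) + S         ≈⟨ +-congʳ (*-congˡ (-‿distribˡ-* u S)) ⟨
    f 0 * - (u * S) + S         ≈⟨ +-congʳ (-‿distribʳ-* (f 0) (u * S)) ⟨
    - (f 0 * (u * S)) + S       ≈⟨ +-congʳ (-‿cong (*-assoc (f 0) u S)) ⟨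
    - (f 0 * u * S) + S         ≈⟨ +-congʳ (-‿cong (trans (*-congʳ f₀u≈1) (*-identityˡ S))) ⟩
    - S + S                     ≈⟨ -‿inverseˡ S ⟩
    0#                          ∎
    where
    S S′ : Carrier
    S  = sum {suc n} λ i → f (suc (toℕ i)) * lookup (inverseCoeffs f u n) i
    S′ = sum {suc n} λ i → f (suc (toℕ i)) * inverse f u (n ∸ toℕ i)
    S′≡S : S′ ≡ S
    S′≡S = sum-cong-≗ {suc n} λ i →
      ≡.cong (f (suc (toℕ i)) *_) (≡.sym (lookup-inverseCoeffs f u n i))

  x-1-inverse : (X -ₛ 1ₛ) *ₛ inverse (X -ₛ 1ₛ) (- 1#) ≈ₛ 1ₛ
  x-1-inverse = *-inverse (X -ₛ 1ₛ) (- 1#) (begin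
    (0# - 1#) * - 1#  ≈⟨ *-congʳ (+-identityˡ (- 1#)) ⟩
    - 1# * - 1#       ≈⟨ -‿distribˡ-* 1# (- 1#) ⟨
    - (1# * - 1#)     ≈⟨ -‿cong (*-identityˡ (- 1#)) ⟩
    - - 1#            ≈⟨ -‿involutive 1# ⟩
    1#                ∎)

  1-x-inverse : (1ₛ -ₛ X) *ₛ inverse (1ₛ -ₛ X) 1# ≈ₛ 1ₛ
  1-x-inverse = *-inverse (1ₛ -ₛ X) 1# (begin
    (1# - 0#) * 1#  ≈⟨ *-identityʳ (1# - 0#) ⟩
    1# - 0#         ≈⟨ +-congˡ -0#≈0# ⟩
    1# + 0#         ≈⟨ +-identityʳ 1# ⟩
    1#              ∎)

  x/[x-1] : Series
  x/[x-1] = X *ₛ inverse (X -ₛ 1ₛ) (- 1#)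

  [1-x]^_ : ℤ → Series
  [1-x]^ (+ n)    = (1ₛ -ₛ X) ^ₛ n
  [1-x]^ -[1+ n ] = inverse (1ₛ -ₛ X) 1# ^ₛ suc n

  _∈𝓕_ : Series → ℤ → Set ℓ
  φ ∈𝓕 r = φ ∘ₛ x/[x-1] ≈ₛ ([1-x]^ r) *ₛ φ

  coeff : Series → ℤ → Carrier
  coeff γ (+ n)    = γ n
  coeff γ -[1+ _ ] = 0#

  -- ∑ℤ a b f = f(a) + f(a+1) + … + f(b), the empty sum if b < a.
  ∑ℤ : ℤ → ℤ → (ℤ → Carrier) → Carrier
  ∑ℤ a b f = sum {size (b ℤ.- a)} λ j → f (a ℤ.+ + toℕ j)
    where
    size : ℤ → ℕ
    size (+ m)    = suc m
    size -[1+ _ ] = 0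

CharacteristicZero : HeytingField c ℓ₁ ℓ₂ → Set ℓ₂
CharacteristicZero K = ∀ n → (suc n · 1#) # 0#
  where
  open HeytingField K
  open HeytingCommutativeRing heytingCommutativeRing using (commutativeRing)
  open CommutativeRing commutativeRing using (+-rawMonoid)
  open RawMonoidDefs +-rawMonoid using () renaming (_×_ to _·_)

-- K plays the role of ℚ, ℝ or ℂ.
module OverField (K : HeytingField c ℓ₁ ℓ₂) (char0 : CharacteristicZero K) where

  open HeytingCommutativeRing (HeytingField.heytingCommutativeRing K) public
    using (commutativeRing)
  open HeytingField K using (#⇒invertible)
  open CommutativeRing commutativeRing
  open RawMonoidDefs +-rawMonoid using () renaming (_×_ to _·_)
  open PowerSeries commutativeRing public
  open RingProperties ring using (-0#≈0#; -‿distribˡ-*; -‿distribʳ-*; -‿involutive)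
  open SemiringSum semiring using (sum; sum-cong-≋)
  open import Relation.Binary.Reasoning.Setoid setoid

  fromℕ : ℕ → Carrier
  fromℕ n = n · 1#

  fromℤ : ℤ → Carrier
  fromℤ (+ n)    = fromℕ n
  fromℤ -[1+ n ] = - fromℕ (suc n)

  -- 1/z in K, with the junk value 1/0 = 0.
  recip : ℤ → Carrier
  recip (+ zero) = 0#
  recip +[1+ n ] = proj₁ (#⇒invertible (char0 n))
  recip -[1+ n ] = - recip +[1+ n ]

  *-recip-suc : ∀ n → fromℕ (suc n) * recip +[1+ n ] ≈ 1#
  *-recip-suc n = begin
    fromℕ (suc n) * recip +[1+ n ]         ≈⟨ *-congʳ (trans (+-congˡ -0#≈0#) (+-identityʳ _)) ⟨
    (fromℕ (suc n) - 0#) * recip +[1+ n ]  ≈⟨ proj₂ (proj₂ (#⇒invertible (char0 n))) ⟩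
    1#                                     ∎

  *-recip : ∀ z → z ≢ 0ℤ → fromℤ z * recip z ≈ 1#
  *-recip (+ zero) z≢0 with () ← z≢0 ≡.refl
  *-recip +[1+ n ] _ = *-recip-suc n
  *-recip -[1+ n ] _ = begin
    - a * - b    ≈⟨ -‿distribˡ-* a (- b) ⟨
    - (a * - b)  ≈⟨ -‿cong (-‿distribʳ-* a b) ⟨
    - - (a * b)  ≈⟨ -‿involutive (a * b) ⟩
    a * b        ≈⟨ *-recip-suc n ⟩
    1#           ∎
    where
    a b : Carrier
    a = fromℕ (suc n)
    b = recip +[1+ n ]

  exp : Series
  exp n = recip (+ (n !))

  [exp-1]/t : Series
  [exp-1]/t n = exp (suc n)

  bernoulli : ℕ → Carrier
  bernoulli n = fromℕ (n !) * inverse [exp-1]/t 1# n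

  *-recip-! : ∀ n → fromℕ (n !) * recip (+ (n !)) ≈ 1#
  *-recip-! n = *-recip (+ (n !)) λ n!≡0 → ℕ.≢-nonZero⁻¹ (n !) {{n !≢0}} (+-injective n!≡0)
    where open import Data.Integer.Properties using (+-injective)

  -- The defining identity (eᵗ - 1) · ∑ Bₙ tⁿ/n! = t.
  bernoulli-generating : (exp -ₛ 1ₛ) *ₛ (λ n → bernoulli n * recip (+ (n !))) ≈ₛ X
  bernoulli-generating = coefficients
    where
    b : Series
    b m = bernoulli m * recip (+ (m !))

    -- exp 0 and exp 1 coincide definitionally, as 0 ! = 1 ! = 1.
    exp₀≈1 : exp 0 ≈ 1#
    exp₀≈1 = begin
      exp 0            ≈⟨ *-identityˡ (exp 0) ⟨
      1# * exp 0       ≈⟨ *-congʳ (+-identityʳ 1#) ⟨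
      fromℕ 1 * exp 0  ≈⟨ *-recip-! 0 ⟩
      1#               ∎

    [exp₀-1]y≈0 : ∀ y → (exp 0 - 1#) * y ≈ 0#
    [exp₀-1]y≈0 y = trans (*-congʳ (trans (+-congʳ exp₀≈1) (-‿inverseʳ 1#))) (zeroˡ y)

    x-0≈x : ∀ x → x - 0# ≈ x
    x-0≈x x = trans (+-congˡ -0#≈0#) (+-identityʳ x)

    b≈inverse : ∀ m → b m ≈ inverse [exp-1]/t 1# m
    b≈inverse m = begin
      fromℕ (m !) * g * recip (+ (m !))    ≈⟨ *-congʳ (*-comm (fromℕ (m !)) g) ⟩
      g * fromℕ (m !) * recip (+ (m !))    ≈⟨ *-assoc g _ _ ⟩
      g * (fromℕ (m !) * recip (+ (m !)))  ≈⟨ *-congˡ (*-recip-! m) ⟩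
      g * 1#                               ≈⟨ *-identityʳ g ⟩
      g                                    ∎
      where
      g : Carrier
      g = inverse [exp-1]/t 1# m

    coefficients : (exp -ₛ 1ₛ) *ₛ b ≈ₛ X
    coefficients zero    = trans (+-identityʳ _) ([exp₀-1]y≈0 (b 0))
    coefficients (suc n) = begin
      (exp 0 - 1#) * b (suc n) + rest        ≈⟨ +-congʳ ([exp₀-1]y≈0 (b (suc n))) ⟩
      0# + rest                              ≈⟨ +-identityˡ rest ⟩
      rest                                   ≈⟨ sum-cong-≋ {suc n} (λ i →
                                                  *-cong (x-0≈x (exp (suc (toℕ i)))) (b≈inverse (n ∸ toℕ i))) ⟩
      ([exp-1]/t *ₛ inverse [exp-1]/t 1#) n  ≈⟨ *-inverse [exp-1]/t 1# (trans (*-identityʳ (exp 1)) exp₀≈1) n ⟩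
      1ₛ n                                   ∎
      where
      rest : Carrier
      rest = sum {suc n} λ i → (exp (suc (toℕ i)) - 0#) * b (n ∸ toℕ i)

  -- Absolute values serve only to turn integers into naturals: the arguments
  -- of binom and B are nonnegative wherever the conditions below use them.
  binom : ℤ → ℤ → Carrier
  binom a b = fromℕ (∣ a ∣ C ∣ b ∣)

  B : ℤ → Carrier
  B m = bernoulli ∣ m ∣


  -- Used with r = 2k or r = 2k + 1.
  Star : Series → (r k n : ℤ) → Set ℓ₁
  Star γ r k n =
    coeff γ (+ 2 ℤ.* n) ≈
      fromℕ 2 * recip (+ 2 ℤ.* n ℤ.+ r) *
        ∑ℤ (ℤ.- k) n λ i →
          binom (+ 2 ℤ.* n ℤ.+ r) (+ 2 ℤ.* i ℤ.+ r) *
          B (+ 2 ℤ.* n ℤ.- + 2 ℤ.* i) * coeff γ (+ 2 ℤ.* i ℤ.+ 1ℤ)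

  StarStar : Series → (r n : ℤ) → Set ℓ₁
  StarStar γ r n =
    coeff γ (+ 2 ℤ.* n) ≈
      ∑ℤ 0ℤ n λ i →
        fromℕ 2 * recip (+ 2 ℤ.* i ℤ.+ r) *
        binom (ℤ.- (+ 2 ℤ.* i) ℤ.- r) (ℤ.- (+ 2 ℤ.* n) ℤ.- r) *
        B (+ 2 ℤ.* n ℤ.- + 2 ℤ.* i) * coeff γ (+ 2 ℤ.* i ℤ.+ 1ℤ)

  EvenConditions : Series → (r k : ℤ) → Set ℓ₁
  EvenConditions γ r k =
    (∀ n → 0ℤ ℤ.⊔ (1ℤ ℤ.- k) ℤ.≤ n → Star γ r k n) ×
    (r ℤ.≤ 0ℤ → coeff γ (1ℤ ℤ.- r) ≈ 0#) ×
    (r ℤ.< 0ℤ → ∀ n → 0ℤ ℤ.≤ n → n ℤ.≤ ℤ.- k ℤ.- 1ℤ → StarStar γ r n)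

  OddConditions : Series → (r k : ℤ) → Set ℓ₁
  OddConditions γ r k =
    (∀ n → 0ℤ ℤ.⊔ (ℤ.- k) ℤ.≤ n → Star γ r k n) ×
    (r ℤ.< 0ℤ → ∀ n → 0ℤ ℤ.≤ n → n ℤ.≤ ℤ.- k ℤ.- 1ℤ → StarStar γ r n)

  Conditions : Series → ℤ → Set ℓ₁
  Conditions γ r =
    (∀ k → r ≡ + 2 ℤ.* k → EvenConditions γ r k) ×
    (∀ k → r ≡ + 2 ℤ.* k ℤ.+ 1ℤ → OddConditions γ r k)

{-# OPTIONS --safe #-}
module Submission where

-- Comparing coefficients in φ(x) = (1-x)^(-r) φ(x/(x-1)) gives, for every n,
-- γₙ = ∑ᵢ (-1)ⁱ C(n+r-1, n-i) γᵢ.  For n > -r only the γᵢ with i > -r occur, and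
-- for n ≤ -r the binomial coefficient is (-1)ⁿ⁻ⁱ C(-r-i, n-i); so the degrees
-- above and up to -r separate.  Weighted by suitable factorials, each half
-- becomes a functional equation G(t) = eᵗ G(-t), up to a sign absorbed by a
-- factor t, and truncated after degree -r for the lower half.  It says that
-- e^(-t/2) G(t) is even, i.e. that the even part of G is coth(t/2) times its
-- odd part, and t coth(t/2) = ∑ 2 B₂ₙ t²ⁿ/(2n)!.  Comparing coefficients again
-- yields (∗) and (∗∗).

open import Algebra.Apartness.Bundles using (HeytingField)
open import Algebra.Bundles using (CommutativeRing)
import Algebra.Definitions.RawMonoid as RawMonoidDefs
import Algebra.Properties.Ring as RingProperties
import Algebra.Properties.Semiring.Mult as SemiringMult
import Algebra.Properties.Semiring.Sum as SemiringSum
import Algebra.Solver.Ring.NaturalCoefficients.Default as SemiringSolver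
open import Data.Empty using (⊥)
open import Data.Fin.Base using (toℕ)
open import Data.Integer.Base as ℤ using (ℤ; +_; -[1+_]; +[1+_]; 0ℤ; 1ℤ; ∣_∣)
import Data.Integer.Properties as ℤₚ
open import Data.Integer.Tactic.RingSolver using (solve-∀)
open import Data.Nat.Base as ℕ using (ℕ; zero; suc; _∸_; s≤s; z≤n; _!)
open import Data.Nat.Combinatorics using (_C_; nCn≡1; nCk+nC[k+1]≡[n+1]C[k+1]; k>n⇒nCk≡0; nCk≡n!/k![n-k]!; k![n∸k]!∣n!)
open import Data.Nat.DivMod using (m/n*n≡m)
import Data.Nat.Properties as ℕₚ
open import Data.Product.Base using (_×_; _,_; ∃-syntax)
open import Data.Sum.Base using (_⊎_; inj₁; inj₂)
open import Defs
open import Function.Base using (_∘_)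
open import Function.Bundles using (_⇔_; mk⇔; module Equivalence)
open import Level using (Level)
open import Relation.Binary.PropositionalEquality as ≡ using (_≡_; _≢_)
import Relation.Binary.Reasoning.Setoid as SetoidReasoning
open import Relation.Nullary using (yes; no; contradiction)

-- The series e^(-t/2) is never formed. With u = (e^t - 1)/t, the identity `defect` amounts to e^t
-- G(-t) - G(t) = u (t even - t coth(t/2) odd), and u is invertible. So the functional equation and
-- the relation between even and odd parts imply each other up to any degree N, because a product
-- through degree N sees its factors only through degree N. This is what gives access to the
-- truncated lower half. At even degrees t even = t coth(t/2) odd reads 0 = 0, so all information
-- sits at the degrees 2m+1, and each of these expresses one even coefficient. This explains the
-- exceptions for even r ≤ 0. The lower half stops at the even degree -r, whose coefficient could be
-- fixed only by the following degree, and so it stays free. In the upper half the extra factor t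
-- moves γ_(1-r) to index 1, where the relation reads 0 = 2 γ_(1-r). Index p of the upper generating
-- function belongs to degree p + 1 - r of γ, which may be negative; as γ is zero there, equations
-- without a counterpart on the other side hold trivially.

module SeriesRing {c ℓ : Level} (R : CommutativeRing c ℓ) where

  open CommutativeRing R
  open PowerSeries R
  open RingProperties ring
  open SemiringSum semiring using (sum)
  open SemiringSolver commutativeSemiring using (solve; _:=_; _:+_; _:*_)
  open SetoidReasoning setoid

  -- Finite sums and the ring of formal power series.

  Σ< : ℕ → (ℕ → Carrier) → Carrier
  Σ< n f = sum {n} λ i → f (toℕ i)

  Σ<-cong-< : ∀ n {f g : ℕ → Carrier} → (∀ i → i ℕ.< n → f i ≈ g i) → Σ< n f ≈ Σ< n g
  Σ<-cong-< zero    f≈g = refl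
  Σ<-cong-< (suc n) f≈g = +-cong (f≈g 0 (s≤s z≤n)) (Σ<-cong-< n λ i i<n → f≈g (suc i) (s≤s i<n))

  Σ<-cong : ∀ n {f g : ℕ → Carrier} → (∀ i → f i ≈ g i) → Σ< n f ≈ Σ< n g
  Σ<-cong n f≈g = Σ<-cong-< n λ i _ → f≈g i

  Σ<-zero : ∀ n {f : ℕ → Carrier} → (∀ i → i ℕ.< n → f i ≈ 0#) → Σ< n f ≈ 0#
  Σ<-zero zero    f≈0 = refl
  Σ<-zero (suc n) f≈0 =
    trans (+-cong (f≈0 0 (s≤s z≤n)) (Σ<-zero n λ i i<n → f≈0 (suc i) (s≤s i<n))) (+-identityˡ 0#)

  Σ<-+ : ∀ n (f g : ℕ → Carrier) → Σ< n (λ i → f i + g i) ≈ Σ< n f + Σ< n g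
  Σ<-+ n f g = SemiringSum.∑-distrib-+ semiring {n} (λ i → f (toℕ i)) (λ i → g (toℕ i))

  Σ<-*ˡ : ∀ n x (f : ℕ → Carrier) → x * Σ< n f ≈ Σ< n (λ i → x * f i)
  Σ<-*ˡ n x f = SemiringSum.*-distribˡ-sum semiring {n} x (λ i → f (toℕ i))

  Σ<-*ʳ : ∀ n x (f : ℕ → Carrier) → Σ< n f * x ≈ Σ< n (λ i → f i * x)
  Σ<-*ʳ n x f = SemiringSum.*-distribʳ-sum semiring {n} x (λ i → f (toℕ i))

  Σ<-comm : ∀ m n (f : ℕ → ℕ → Carrier) →
            Σ< m (λ i → Σ< n (f i)) ≈ Σ< n (λ j → Σ< m (λ i → f i j))
  Σ<-comm m n f = SemiringSum.∑-comm semiring {m} {n} (λ i j → f (toℕ i) (toℕ j))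

  -- Whichever sum is longer, its overhang vanishes, so no comparison of `m` and `n` is required.
  -- This serves to square a triangular double sum and to match sums whose natural ranges differ by
  -- a shift of either sign.
  Σ<-cong-length : ∀ m n {f g : ℕ → Carrier} →
                   (∀ i → i ℕ.< m → i ℕ.< n → f i ≈ g i) →
                   (∀ i → i ℕ.< m → n ℕ.≤ i → f i ≈ 0#) →
                   (∀ i → i ℕ.< n → m ℕ.≤ i → g i ≈ 0#) →
                   Σ< m f ≈ Σ< n g
  Σ<-cong-length zero    n       f≈g f≈0 g≈0 = sym (Σ<-zero n λ i i<n → g≈0 i i<n z≤n)
  Σ<-cong-length (suc m) zero    f≈g f≈0 g≈0 = Σ<-zero (suc m) λ i i<m → f≈0 i i<m z≤n
  Σ<-cong-length (suc m) (suc n) f≈g f≈0 g≈0 =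
    +-cong (f≈g 0 (s≤s z≤n) (s≤s z≤n))
           (Σ<-cong-length m n
             (λ i i<m i<n → f≈g (suc i) (s≤s i<m) (s≤s i<n))
             (λ i i<m n≤i → f≈0 (suc i) (s≤s i<m) (s≤s n≤i))
             (λ i i<n m≤i → g≈0 (suc i) (s≤s i<n) (s≤s m≤i)))

  infixl 6 _+ₛ_
  _+ₛ_ : Series → Series → Series
  (f +ₛ g) n = f n + g n

  -ₛ_ : Series → Series
  (-ₛ f) n = - f n

  0ₛ : Series
  0ₛ _ = 0#

  *ₛ-cong : ∀ {f f′ g g′} → f ≈ₛ f′ → g ≈ₛ g′ → f *ₛ g ≈ₛ f′ *ₛ g′
  *ₛ-cong f≈f′ g≈g′ n = Σ<-cong (suc n) λ i → *-cong (f≈f′ i) (g≈g′ (n ∸ i))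

  *ₛ-distribʳ : ∀ h f g → (f +ₛ g) *ₛ h ≈ₛ f *ₛ h +ₛ g *ₛ h
  *ₛ-distribʳ h f g n = trans
    (Σ<-cong (suc n) λ i → distribʳ (h (n ∸ i)) (f i) (g i))
    (Σ<-+ (suc n) (λ i → f i * h (n ∸ i)) (λ i → g i * h (n ∸ i)))

  *ₛ-scaleˡ : ∀ x f g n → ((λ i → x * f i) *ₛ g) n ≈ x * (f *ₛ g) n
  *ₛ-scaleˡ x f g n = trans
    (Σ<-cong (suc n) λ i → *-assoc x (f i) (g (n ∸ i)))
    (sym (Σ<-*ˡ (suc n) x λ i → f i * g (n ∸ i)))

  -- The product unfolds definitionally at index 0 of `f`; this is the mirror unfolding, at index 0
  -- of `g`. Commutativity follows by induction from the two together.
  *ₛ-suc : ∀ f g n → (f *ₛ g) (suc n) ≈ f (suc n) * g 0 + (f *ₛ (g ∘ suc)) n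
  *ₛ-suc f g zero    =
    solve 3 (λ a b o → a :+ (b :+ o) := b :+ (a :+ o)) refl (f 0 * g 1) (f 1 * g 0) 0#
  *ₛ-suc f g (suc n) = begin
    f 0 * g (2 ℕ.+ n) + ((f ∘ suc) *ₛ g) (suc n)
      ≈⟨ +-congˡ (*ₛ-suc (f ∘ suc) g n) ⟩
    f 0 * g (2 ℕ.+ n) + (f (2 ℕ.+ n) * g 0 + ((f ∘ suc) *ₛ (g ∘ suc)) n)
      ≈⟨ solve 3 (λ a b o → a :+ (b :+ o) := b :+ (a :+ o)) refl _ _ _ ⟩
    f (2 ℕ.+ n) * g 0 + (f 0 * g (2 ℕ.+ n) + ((f ∘ suc) *ₛ (g ∘ suc)) n)
      ∎

  *ₛ-comm : ∀ f g → f *ₛ g ≈ₛ g *ₛ f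
  *ₛ-comm f g zero    = +-congʳ (*-comm (f 0) (g 0))
  *ₛ-comm f g (suc n) = begin
    f 0 * g (suc n) + ((f ∘ suc) *ₛ g) n  ≈⟨ +-cong (*-comm (f 0) (g (suc n))) (*ₛ-comm (f ∘ suc) g n) ⟩
    g (suc n) * f 0 + (g *ₛ (f ∘ suc)) n  ≈⟨ *ₛ-suc g f n ⟨
    (g *ₛ f) (suc n)                      ∎

  *ₛ-assoc : ∀ f g h → (f *ₛ g) *ₛ h ≈ₛ f *ₛ (g *ₛ h)
  *ₛ-assoc f g h zero    =
    +-congʳ (begin
      (f 0 * g 0 + 0#) * h 0  ≈⟨ *-congʳ (+-identityʳ _) ⟩
      f 0 * g 0 * h 0         ≈⟨ *-assoc _ _ _ ⟩
      f 0 * (g 0 * h 0)       ≈⟨ *-congˡ (+-identityʳ _) ⟨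
      f 0 * (g 0 * h 0 + 0#)  ∎)
  *ₛ-assoc f g h (suc n) = begin
    (f 0 * g 0 + 0#) * h (suc n) + (((f *ₛ g) ∘ suc) *ₛ h) n
      ≈⟨ +-cong (*-congʳ (+-identityʳ _)) (*ₛ-distribʳ h (λ i → f 0 * g (suc i)) ((f ∘ suc) *ₛ g) n) ⟩
    f 0 * g 0 * h (suc n) + (((λ i → f 0 * g (suc i)) *ₛ h) n + (((f ∘ suc) *ₛ g) *ₛ h) n)
      ≈⟨ +-congˡ (+-cong (*ₛ-scaleˡ (f 0) (g ∘ suc) h n) (*ₛ-assoc (f ∘ suc) g h n)) ⟩
    f 0 * g 0 * h (suc n) + (f 0 * ((g ∘ suc) *ₛ h) n + ((f ∘ suc) *ₛ (g *ₛ h)) n)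
      ≈⟨ solve 5 (λ a b c d e → a :* b :* c :+ (a :* d :+ e) := a :* (b :* c :+ d) :+ e)
           refl (f 0) (g 0) (h (suc n)) (((g ∘ suc) *ₛ h) n) (((f ∘ suc) *ₛ (g *ₛ h)) n) ⟩
    f 0 * (g 0 * h (suc n) + ((g ∘ suc) *ₛ h) n) + ((f ∘ suc) *ₛ (g *ₛ h)) n
      ∎

  *ₛ-identityˡ : ∀ f → 1ₛ *ₛ f ≈ₛ f
  *ₛ-identityˡ f zero    = trans (+-identityʳ _) (*-identityˡ (f 0))
  *ₛ-identityˡ f (suc n) = trans
    (+-cong (*-identityˡ (f (suc n))) (Σ<-zero (suc n) λ i _ → zeroˡ (f (n ∸ i))))
    (+-identityʳ (f (suc n)))

  *ₛ-identityʳ : ∀ f → f *ₛ 1ₛ ≈ₛ f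
  *ₛ-identityʳ f n = trans (*ₛ-comm f 1ₛ n) (*ₛ-identityˡ f n)

  *ₛ-distribˡ : ∀ h f g → h *ₛ (f +ₛ g) ≈ₛ h *ₛ f +ₛ h *ₛ g
  *ₛ-distribˡ h f g n = begin
    (h *ₛ (f +ₛ g)) n        ≈⟨ *ₛ-comm h (f +ₛ g) n ⟩
    ((f +ₛ g) *ₛ h) n        ≈⟨ *ₛ-distribʳ h f g n ⟩
    (f *ₛ h +ₛ g *ₛ h) n     ≈⟨ +-cong (*ₛ-comm f h n) (*ₛ-comm g h n) ⟩
    (h *ₛ f +ₛ h *ₛ g) n     ∎

  -- Packaged so that the semiring solver and the generic ring lemmas apply to whole series instead
  -- of coefficients.
  seriesRing : CommutativeRing c ℓ
  seriesRing = record
    { Carrier = Series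
    ; _≈_ = _≈ₛ_
    ; _+_ = _+ₛ_
    ; _*_ = _*ₛ_
    ; -_ = -ₛ_
    ; 0# = 0ₛ
    ; 1# = 1ₛ
    ; isCommutativeRing = record
      { isRing = record
        { +-isAbelianGroup = record
          { isGroup = record
            { isMonoid = record
              { isSemigroup = record
                { isMagma = record
                  { isEquivalence = record
                    { refl = λ _ → refl
                    ; sym = λ f≈g n → sym (f≈g n)
                    ; trans = λ f≈g g≈h n → trans (f≈g n) (g≈h n)
                    }
                  ; ∙-cong = λ f≈f′ g≈g′ n → +-cong (f≈f′ n) (g≈g′ n)
                  }
                ; assoc = λ f g h n → +-assoc (f n) (g n) (h n)
                }
              ; identity = (λ f n → +-identityˡ (f n)) , (λ f n → +-identityʳ (f n))
              }
            ; inverse = (λ f n → -‿inverseˡ (f n)) , (λ f n → -‿inverseʳ (f n))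
            ; ⁻¹-cong = λ f≈g n → -‿cong (f≈g n)
            }
          ; comm = λ f g n → +-comm (f n) (g n)
          }
        ; *-cong = *ₛ-cong
        ; *-assoc = *ₛ-assoc
        ; *-identity = *ₛ-identityˡ , *ₛ-identityʳ
        ; distrib = *ₛ-distribˡ , *ₛ-distribʳ
        }
      ; *-comm = *ₛ-comm
      }
    }

  X*-suc : ∀ f n → (X *ₛ f) (suc n) ≈ f n
  X*-suc f n = trans (trans (+-congʳ (zeroˡ (f (suc n)))) (+-identityˡ _)) (*ₛ-identityˡ f n)

  X*-zero : ∀ f → (X *ₛ f) 0 ≈ 0#
  X*-zero f = trans (+-identityʳ _) (zeroˡ (f 0))

  X*-cancel : ∀ {f g} → X *ₛ f ≈ₛ X *ₛ g → f ≈ₛ g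
  X*-cancel {f} {g} Xf≈Xg n = trans (sym (X*-suc f n)) (trans (Xf≈Xg (suc n)) (X*-suc g n))

  sgn : ℕ → Carrier
  sgn zero    = 1#
  sgn (suc n) = - sgn n

  -- f(-x)
  infix 10 _ᵒ
  _ᵒ : Series → Series
  (f ᵒ) n = sgn n * f n

  -x*-y≈x*y : ∀ x y → - x * - y ≈ x * y
  -x*-y≈x*y x y = begin
    - x * - y    ≈⟨ -‿distribˡ-* x (- y) ⟨
    - (x * - y)  ≈⟨ -‿cong (-‿distribʳ-* x y) ⟨
    - - (x * y)  ≈⟨ -‿involutive (x * y) ⟩
    x * y        ∎

  sgn² : ∀ n → sgn n * sgn n ≈ 1#
  sgn² zero    = *-identityˡ 1#
  sgn² (suc n) = trans (-x*-y≈x*y (sgn n) (sgn n)) (sgn² n)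

  sgn-+ : ∀ m n → sgn (m ℕ.+ n) ≈ sgn m * sgn n
  sgn-+ zero    n = sym (*-identityˡ (sgn n))
  sgn-+ (suc m) n = trans (-‿cong (sgn-+ m n)) (-‿distribˡ-* (sgn m) (sgn n))

  ᵒ-* : ∀ f g → (f *ₛ g) ᵒ ≈ₛ f ᵒ *ₛ g ᵒ
  ᵒ-* f g n = trans (Σ<-*ˡ (suc n) (sgn n) λ i → f i * g (n ∸ i))
    (Σ<-cong-< (suc n) λ { i (s≤s i≤n) → begin
      sgn n * (f i * g (n ∸ i))
        ≈⟨ *-congʳ (trans (reflexive (≡.cong sgn (≡.sym (ℕₚ.m+[n∸m]≡n i≤n)))) (sgn-+ i (n ∸ i))) ⟩
      sgn i * sgn (n ∸ i) * (f i * g (n ∸ i))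
        ≈⟨ solve 4 (λ a b c d → a :* b :* (c :* d) := a :* c :* (b :* d)) refl _ _ _ _ ⟩
      sgn i * f i * (sgn (n ∸ i) * g (n ∸ i)) ∎ })

  ᵒ-involutive : ∀ f → (f ᵒ) ᵒ ≈ₛ f
  ᵒ-involutive f n = begin
    sgn n * (sgn n * f n)  ≈⟨ *-assoc _ _ _ ⟨
    sgn n * sgn n * f n    ≈⟨ *-congʳ (sgn² n) ⟩
    1# * f n               ≈⟨ *-identityˡ (f n) ⟩
    f n                    ∎

-- Membership in 𝓕 as a binomial recurrence for the coefficients.

module Fixed {c ℓ : Level} (R : CommutativeRing c ℓ) where

  open CommutativeRing R
  open PowerSeries R
  open SeriesRing R
  open RingProperties ring
  open SemiringSolver commutativeSemiring using (solve; _:=_; _:+_; _:*_)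
  open RawMonoidDefs +-rawMonoid using () renaming (_×_ to _·_)
  open SemiringMult semiring using (×-homo-+)
  open SetoidReasoning setoid

  module S = CommutativeRing seriesRing
  module SP = RingProperties S.ring
  module SR = SetoidReasoning S.setoid
  module SS = SemiringSolver S.commutativeSemiring

  private
    L Y : Series
    L = 1ₛ -ₛ X
    Y = inverse L 1#

  inverse-unique : ∀ f g h → f *ₛ g ≈ₛ 1ₛ → f *ₛ h ≈ₛ 1ₛ → g ≈ₛ h
  inverse-unique f g h fg≈1 fh≈1 = SR.begin
    g              SR.≈⟨ *ₛ-identityʳ g ⟨
    g *ₛ 1ₛ        SR.≈⟨ S.*-congˡ {g} fh≈1 ⟨
    g *ₛ (f *ₛ h)  SR.≈⟨ *ₛ-assoc g f h ⟨
    g *ₛ f *ₛ h    SR.≈⟨ S.*-congʳ {h} (S.trans (*ₛ-comm g f) fg≈1) ⟩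
    1ₛ *ₛ h        SR.≈⟨ *ₛ-identityˡ h ⟩
    h              SR.∎

  *-cancel-inverseˡ : ∀ f g h → f *ₛ g ≈ₛ 1ₛ → f *ₛ (g *ₛ h) ≈ₛ h
  *-cancel-inverseˡ f g h fg≈1 =
    S.trans (S.sym (*ₛ-assoc f g h)) (S.trans (S.*-congʳ {h} fg≈1) (*ₛ-identityˡ h))

  [1-x]^-suc : ∀ z → [1-x]^ (ℤ.suc z) ≈ₛ L *ₛ ([1-x]^ z)
  [1-x]^-suc (+ n)        = S.refl
  [1-x]^-suc -[1+ zero ]  = S.sym (*-cancel-inverseˡ L Y 1ₛ 1-x-inverse)
  [1-x]^-suc -[1+ suc n ] = S.sym (*-cancel-inverseˡ L Y ([1-x]^ -[1+ n ]) 1-x-inverse)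

  [1-x]^-pred : ∀ z → [1-x]^ (ℤ.pred z) ≈ₛ Y *ₛ ([1-x]^ z)
  [1-x]^-pred z = SR.begin
    [1-x]^ (ℤ.pred z)
      SR.≈⟨ *-cancel-inverseˡ Y L ([1-x]^ (ℤ.pred z)) (S.trans (*ₛ-comm Y L) 1-x-inverse) ⟨
    Y *ₛ (L *ₛ ([1-x]^ (ℤ.pred z)))   SR.≈⟨ S.*-congˡ {Y} ([1-x]^-suc (ℤ.pred z)) ⟨
    Y *ₛ ([1-x]^ ℤ.suc (ℤ.pred z))    SR.≡⟨ ≡.cong (λ w → Y *ₛ ([1-x]^ w)) (ℤₚ.suc-pred z) ⟩
    Y *ₛ ([1-x]^ z)                   SR.∎

  [1-x]^-inverse : ∀ z → [1-x]^ z *ₛ [1-x]^ (ℤ.- z) ≈ₛ 1ₛ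
  [1-x]^-inverse (+ n) = go n
    where
    go : ∀ n → [1-x]^ (+ n) *ₛ [1-x]^ (ℤ.- + n) ≈ₛ 1ₛ
    go zero    = *ₛ-identityˡ 1ₛ
    go (suc n) = SR.begin
      (L *ₛ a) *ₛ [1-x]^ -[1+ n ]      SR.≡⟨ ≡.cong (λ w → (L *ₛ a) *ₛ [1-x]^ w) (ℤₚ.neg-suc n) ⟩
      (L *ₛ a) *ₛ [1-x]^ (ℤ.pred (ℤ.- + n))  SR.≈⟨ S.*-congˡ {L *ₛ a} ([1-x]^-pred (ℤ.- + n)) ⟩
      (L *ₛ a) *ₛ (Y *ₛ b)
        SR.≈⟨ SS.solve 4 (λ l x y z → (l SS.:* x) SS.:* (y SS.:* z) SS.:= (l SS.:* (y SS.:* (x SS.:* z))))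
             S.refl L a Y b ⟩
      L *ₛ (Y *ₛ (a *ₛ b))             SR.≈⟨ *-cancel-inverseˡ L Y (a *ₛ b) 1-x-inverse ⟩
      a *ₛ b                           SR.≈⟨ go n ⟩
      1ₛ                               SR.∎
      where
      a b : Series
      a = [1-x]^ (+ n)
      b = [1-x]^ (ℤ.- + n)
  [1-x]^-inverse -[1+ n ] = S.trans (*ₛ-comm ([1-x]^ -[1+ n ]) ([1-x]^ (+ suc n))) ([1-x]^-inverse (+ suc n))

  x/[x-1]≈-x/[1-x] : x/[x-1] ≈ₛ (-ₛ X) *ₛ Y
  x/[x-1]≈-x/[1-x] = SR.begin
    X *ₛ inverse (X -ₛ 1ₛ) (- 1#)
      SR.≈⟨ S.*-congˡ {X} (inverse-unique (X -ₛ 1ₛ) (inverse (X -ₛ 1ₛ) (- 1#)) (-ₛ Y) x-1-inverse [x-1]*-Y≈1) ⟩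
    X *ₛ (-ₛ Y)                    SR.≈⟨ SP.-‿distribʳ-* X Y ⟨
    -ₛ (X *ₛ Y)                    SR.≈⟨ SP.-‿distribˡ-* X Y ⟩
    (-ₛ X) *ₛ Y                    SR.∎
    where
    [x-1]*-Y≈1 : (X -ₛ 1ₛ) *ₛ (-ₛ Y) ≈ₛ 1ₛ
    [x-1]*-Y≈1 = SR.begin
      (X -ₛ 1ₛ) *ₛ (-ₛ Y)  SR.≈⟨ SP.-‿distribʳ-* (X -ₛ 1ₛ) Y ⟨
      -ₛ ((X -ₛ 1ₛ) *ₛ Y)  SR.≈⟨ SP.-‿distribˡ-* (X -ₛ 1ₛ) Y ⟩
      (-ₛ (X -ₛ 1ₛ)) *ₛ Y  SR.≈⟨ S.*-congʳ {Y} (λ n → ⁻¹-anti-homo-// (X n) (1ₛ n)) ⟩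
      L *ₛ Y               SR.≈⟨ 1-x-inverse ⟩
      1ₛ                   SR.∎

  -- Each factor x/(x-1) = -x/(1-x) lowers the exponent of 1-x by one. Thus every term of the
  -- substituted series is a monomial times a single power of 1-x, and the integer exponent keeps
  -- the induction uniform when `w` drops below zero.
  x/[x-1]^*[1-x]^ : ∀ i w → x/[x-1] ^ₛ i *ₛ [1-x]^ w ≈ₛ (-ₛ X) ^ₛ i *ₛ [1-x]^ (w ℤ.- + i)
  x/[x-1]^*[1-x]^ zero    w = S.*-congˡ {1ₛ} (S.reflexive (≡.cong [1-x]^_ (≡.sym (ℤₚ.+-identityʳ w))))
  x/[x-1]^*[1-x]^ (suc i) w = SR.begin
    T *ₛ T ^ₛ i *ₛ [1-x]^ w                    SR.≈⟨ *ₛ-assoc T (T ^ₛ i) ([1-x]^ w) ⟩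
    T *ₛ (T ^ₛ i *ₛ [1-x]^ w)                  SR.≈⟨ *ₛ-cong x/[x-1]≈-x/[1-x] (x/[x-1]^*[1-x]^ i w) ⟩
    -X *ₛ Y *ₛ (-X ^ₛ i *ₛ [1-x]^ (w ℤ.- + i))
      SR.≈⟨ SS.solve 4 (λ l x y z → (l SS.:* x) SS.:* (y SS.:* z) SS.:= (l SS.:* y) SS.:* (x SS.:* z))
           S.refl -X Y (-X ^ₛ i) ([1-x]^ (w ℤ.- + i)) ⟩
    -X *ₛ -X ^ₛ i *ₛ (Y *ₛ [1-x]^ (w ℤ.- + i)) SR.≈⟨ S.*-congˡ {(-X *ₛ -X ^ₛ i)} ([1-x]^-pred (w ℤ.- + i)) ⟨
    -X *ₛ -X ^ₛ i *ₛ [1-x]^ (ℤ.pred (w ℤ.- + i))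
      SR.≡⟨ ≡.cong (λ v → -X *ₛ -X ^ₛ i *ₛ [1-x]^ v) (pred-sub w (+ i)) ⟩
    -X *ₛ -X ^ₛ i *ₛ [1-x]^ (w ℤ.- + suc i)    SR.∎
    where
    T -X : Series
    T  = x/[x-1]
    -X = -ₛ X
    pred-sub : ∀ a b → ℤ.-1ℤ ℤ.+ (a ℤ.- b) ≡ a ℤ.- (1ℤ ℤ.+ b)
    pred-sub = solve-∀

  -X*-suc : ∀ f n → ((-ₛ X) *ₛ f) (suc n) ≈ - f n
  -X*-suc f n = trans (sym (SP.-‿distribˡ-* X f (suc n))) (-‿cong (X*-suc f n))

  -X^*-≤ : ∀ i f n → i ℕ.≤ n → ((-ₛ X) ^ₛ i *ₛ f) n ≈ sgn i * f (n ∸ i)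
  -X^*-≤ zero    f n       _         = trans (*ₛ-identityˡ f n) (sym (*-identityˡ (f n)))
  -X^*-≤ (suc i) f (suc n) (s≤s i≤n) = begin
    (((-ₛ X) *ₛ (-ₛ X) ^ₛ i) *ₛ f) (suc n)  ≈⟨ *ₛ-assoc (-ₛ X) ((-ₛ X) ^ₛ i) f (suc n) ⟩
    ((-ₛ X) *ₛ ((-ₛ X) ^ₛ i *ₛ f)) (suc n)  ≈⟨ -X*-suc ((-ₛ X) ^ₛ i *ₛ f) n ⟩
    - ((-ₛ X) ^ₛ i *ₛ f) n                  ≈⟨ -‿cong (-X^*-≤ i f n i≤n) ⟩
    - (sgn i * f (n ∸ i))                   ≈⟨ -‿distribˡ-* _ _ ⟩
    - sgn i * f (n ∸ i)                     ∎

  -X^*-> : ∀ i f n → n ℕ.< i → ((-ₛ X) ^ₛ i *ₛ f) n ≈ 0#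
  -X^*-> (suc i) f zero    _         = begin
    (((-ₛ X) *ₛ (-ₛ X) ^ₛ i) *ₛ f) 0  ≈⟨ *ₛ-assoc (-ₛ X) ((-ₛ X) ^ₛ i) f 0 ⟩
    - 0# * _ + 0#                     ≈⟨ +-identityʳ _ ⟩
    - 0# * _                          ≈⟨ *-congʳ -0#≈0# ⟩
    0# * _                            ≈⟨ zeroˡ _ ⟩
    0#                                ∎
  -X^*-> (suc i) f (suc n) (s≤s n<i) = begin
    (((-ₛ X) *ₛ (-ₛ X) ^ₛ i) *ₛ f) (suc n)  ≈⟨ *ₛ-assoc (-ₛ X) ((-ₛ X) ^ₛ i) f (suc n) ⟩
    ((-ₛ X) *ₛ ((-ₛ X) ^ₛ i *ₛ f)) (suc n)  ≈⟨ -X*-suc ((-ₛ X) ^ₛ i *ₛ f) n ⟩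
    - ((-ₛ X) ^ₛ i *ₛ f) n                  ≈⟨ -‿cong (-X^*-> i f n n<i) ⟩
    - 0#                                    ≈⟨ -0#≈0# ⟩
    0#                                      ∎

  -- The truncation of `∘ₛ` depends on the degree, which blocks an exchange with the convolution
  -- sum. As g^i has order at least i, all inner sums can be extended to the common bound `n`; then
  -- the two sums commute.
  ∘ₛ-*ₛ : ∀ f g h → (∀ i n → n ℕ.< i → (g ^ₛ i) n ≈ 0#) →
          ∀ n → ((f ∘ₛ g) *ₛ h) n ≈ Σ< (suc n) λ i → f i * (g ^ₛ i *ₛ h) n
  ∘ₛ-*ₛ f g h g^i≈0 n = begin
    Σ< (suc n) (λ j → Σ< (suc j) (λ i → f i * (g ^ₛ i) j) * h (n ∸ j))
      ≈⟨ Σ<-cong-< (suc n) (λ j j<n → *-congʳ {h (n ∸ j)} (Σ<-cong-length (suc j) (suc n)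
           (λ _ _ _ → refl)
           (λ i i≤j n<i → zero-term j i (ℕₚ.≤-trans j<n n<i))
           (λ i _ j<i → zero-term j i j<i))) ⟩
    Σ< (suc n) (λ j → Σ< (suc n) (λ i → f i * (g ^ₛ i) j) * h (n ∸ j))
      ≈⟨ Σ<-cong (suc n) (λ j → trans (Σ<-*ʳ (suc n) (h (n ∸ j)) (λ i → f i * (g ^ₛ i) j))
           (Σ<-cong (suc n) λ i → *-assoc (f i) ((g ^ₛ i) j) (h (n ∸ j)))) ⟩
    Σ< (suc n) (λ j → Σ< (suc n) (λ i → f i * ((g ^ₛ i) j * h (n ∸ j))))
      ≈⟨ Σ<-comm (suc n) (suc n) (λ j i → f i * ((g ^ₛ i) j * h (n ∸ j))) ⟩
    Σ< (suc n) (λ i → Σ< (suc n) (λ j → f i * ((g ^ₛ i) j * h (n ∸ j))))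
      ≈⟨ Σ<-cong (suc n) (λ i → sym (Σ<-*ˡ (suc n) (f i) (λ j → (g ^ₛ i) j * h (n ∸ j)))) ⟩
    Σ< (suc n) (λ i → f i * (g ^ₛ i *ₛ h) n)
      ∎
    where
    zero-term : ∀ j i → j ℕ.< i → f i * (g ^ₛ i) j ≈ 0#
    zero-term j i j<i = trans (*-congˡ (g^i≈0 i j j<i)) (zeroʳ (f i))

  -- The n-th coefficient of φ(x) = (1-x)^(-r) φ(x/(x-1)).
  FixedAt : Series → ℤ → ℕ → Set ℓ
  FixedAt γ r n = γ n ≈ Σ< (suc n) λ i → γ i * (sgn i * ([1-x]^ (ℤ.- r ℤ.- + i)) (n ∸ i))

  private
    substituted : ∀ γ r n → ((γ ∘ₛ x/[x-1]) *ₛ [1-x]^ (ℤ.- r)) n ≈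
                  Σ< (suc n) λ i → γ i * (sgn i * ([1-x]^ (ℤ.- r ℤ.- + i)) (n ∸ i))
    substituted γ r n = trans (∘ₛ-*ₛ γ x/[x-1] ([1-x]^ (ℤ.- r)) vanishes n)
      (Σ<-cong-< (suc n) λ { i (s≤s i≤n) → *-congˡ {γ i}
        (trans (x/[x-1]^*[1-x]^ i (ℤ.- r) n) (-X^*-≤ i ([1-x]^ (ℤ.- r ℤ.- + i)) n i≤n)) })
      where
      -- The exponent w = 0 turns the rewriting of powers into the statement that (x/(x-1))^i has
      -- order at least i.
      vanishes : ∀ i n → n ℕ.< i → (x/[x-1] ^ₛ i) n ≈ 0#
      vanishes i n n<i = begin
        (x/[x-1] ^ₛ i) n                         ≈⟨ *ₛ-identityʳ (x/[x-1] ^ₛ i) n ⟨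
        (x/[x-1] ^ₛ i *ₛ [1-x]^ 0ℤ) n            ≈⟨ x/[x-1]^*[1-x]^ i 0ℤ n ⟩
        ((-ₛ X) ^ₛ i *ₛ [1-x]^ (0ℤ ℤ.- + i)) n   ≈⟨ -X^*-> i ([1-x]^ (0ℤ ℤ.- + i)) n n<i ⟩
        0#                                       ∎

  𝓕⇒FixedAt : ∀ γ r → γ ∈𝓕 r → ∀ n → FixedAt γ r n
  𝓕⇒FixedAt γ r γ∈𝓕 n = begin
    γ n
      ≈⟨ *-cancel-inverseˡ ([1-x]^ (ℤ.- r)) ([1-x]^ r) γ
           (S.trans (*ₛ-comm ([1-x]^ (ℤ.- r)) ([1-x]^ r)) ([1-x]^-inverse r)) n ⟨
    ([1-x]^ (ℤ.- r) *ₛ ([1-x]^ r *ₛ γ)) n            ≈⟨ *ₛ-comm ([1-x]^ (ℤ.- r)) ([1-x]^ r *ₛ γ) n ⟩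
    (([1-x]^ r *ₛ γ) *ₛ [1-x]^ (ℤ.- r)) n            ≈⟨ S.*-congʳ {[1-x]^ (ℤ.- r)} γ∈𝓕 n ⟨
    ((γ ∘ₛ x/[x-1]) *ₛ [1-x]^ (ℤ.- r)) n             ≈⟨ substituted γ r n ⟩
    _                                                ∎

  FixedAt⇒𝓕 : ∀ γ r → (∀ n → FixedAt γ r n) → γ ∈𝓕 r
  FixedAt⇒𝓕 γ r fixed = SR.begin
    γ ∘ₛ x/[x-1]
      SR.≈⟨ *-cancel-inverseˡ ([1-x]^ r) ([1-x]^ (ℤ.- r)) (γ ∘ₛ x/[x-1]) ([1-x]^-inverse r) ⟨
    [1-x]^ r *ₛ ([1-x]^ (ℤ.- r) *ₛ (γ ∘ₛ x/[x-1]))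
      SR.≈⟨ S.*-congˡ {[1-x]^ r} (*ₛ-comm ([1-x]^ (ℤ.- r)) (γ ∘ₛ x/[x-1])) ⟩
    [1-x]^ r *ₛ ((γ ∘ₛ x/[x-1]) *ₛ [1-x]^ (ℤ.- r))
      SR.≈⟨ S.*-congˡ {[1-x]^ r} (λ n → trans (fixed n) (sym (substituted γ r n))) ⟨
    [1-x]^ r *ₛ γ                                    SR.∎

  private
    L*-zero : ∀ f → (L *ₛ f) 0 ≈ f 0
    L*-zero f = begin
      (1# - 0#) * f 0 + 0#  ≈⟨ +-identityʳ _ ⟩
      (1# - 0#) * f 0       ≈⟨ *-congʳ (trans (+-congˡ -0#≈0#) (+-identityʳ 1#)) ⟩
      1# * f 0              ≈⟨ *-identityˡ _ ⟩
      f 0                   ∎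

    L*-suc : ∀ f n → (L *ₛ f) (suc n) ≈ f (suc n) - f n
    L*-suc f n = begin
      (L *ₛ f) (suc n)                    ≈⟨ SP.[y-z]x≈yx-zx f 1ₛ X (suc n) ⟩
      (1ₛ *ₛ f) (suc n) - (X *ₛ f) (suc n) ≈⟨ +-cong (*ₛ-identityˡ f (suc n)) (-‿cong (X*-suc f n)) ⟩
      f (suc n) - f n                     ∎

    pascal : ∀ n k → (n C k) · 1# + (n C suc k) · 1# ≈ (suc n C suc k) · 1#
    pascal n k = trans (sym (×-homo-+ 1# (n C k) (n C suc k)))
      (reflexive (≡.cong (_· 1#) (nCk+nC[k+1]≡[n+1]C[k+1] n k)))

  [1-x]^-coeff-+ : ∀ a m → ([1-x]^ (+ a)) m ≈ sgn m * ((a C m) · 1#)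
  [1-x]^-coeff-+ zero    zero    = sym (trans (*-identityˡ _) (+-identityʳ 1#))
  [1-x]^-coeff-+ zero    (suc m) = sym (zeroʳ (sgn (suc m)))
  [1-x]^-coeff-+ (suc a) zero    = begin
    (L *ₛ [1-x]^ (+ a)) 0   ≈⟨ L*-zero ([1-x]^ (+ a)) ⟩
    ([1-x]^ (+ a)) 0        ≈⟨ [1-x]^-coeff-+ a 0 ⟩
    1# * ((a C 0) · 1#)     ∎
  [1-x]^-coeff-+ (suc a) (suc m) = begin
    (L *ₛ [1-x]^ (+ a)) (suc m)                         ≈⟨ L*-suc ([1-x]^ (+ a)) m ⟩
    ([1-x]^ (+ a)) (suc m) - ([1-x]^ (+ a)) m
      ≈⟨ +-cong ([1-x]^-coeff-+ a (suc m)) (-‿cong ([1-x]^-coeff-+ a m)) ⟩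
    - sgn m * ((a C suc m) · 1#) - sgn m * ((a C m) · 1#)  ≈⟨ +-congˡ (-‿distribˡ-* _ _) ⟩
    - sgn m * ((a C suc m) · 1#) + - sgn m * ((a C m) · 1#)  ≈⟨ distribˡ _ _ _ ⟨
    - sgn m * ((a C suc m) · 1# + (a C m) · 1#)         ≈⟨ *-congˡ (trans (+-comm _ _) (pascal a m)) ⟩
    - sgn m * ((suc a C suc m) · 1#)                    ∎

  -- Multiplication by 1-x takes differences of coefficients. Hence the coefficient at m+1 is the
  -- one at m plus the coefficient at m+1 of the power with exponent one higher, which is Pascal's
  -- rule; the induction runs on `m` and, inside, on `a`.
  [1-x]^-coeff-neg : ∀ a m → ([1-x]^ -[1+ a ]) m ≈ ((a ℕ.+ m) C m) · 1#
  [1-x]^-coeff-neg a zero = trans (constant a) (sym (+-identityʳ 1#))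
    where
    constant : ∀ a → ([1-x]^ -[1+ a ]) 0 ≈ 1#
    constant zero    = trans (sym (L*-zero ([1-x]^ -[1+ 0 ]))) (sym ([1-x]^-suc -[1+ 0 ] 0))
    constant (suc a) = begin
      ([1-x]^ -[1+ suc a ]) 0          ≈⟨ L*-zero ([1-x]^ -[1+ suc a ]) ⟨
      (L *ₛ [1-x]^ -[1+ suc a ]) 0     ≈⟨ [1-x]^-suc -[1+ suc a ] 0 ⟨
      ([1-x]^ -[1+ a ]) 0              ≈⟨ constant a ⟩
      1#                               ∎
  [1-x]^-coeff-neg a (suc m) = begin
    ([1-x]^ -[1+ a ]) (suc m)                            ≈⟨ uncancel ([1-x]^ -[1+ a ]) ⟩
    ([1-x]^ -[1+ a ]) m + (L *ₛ [1-x]^ -[1+ a ]) (suc m)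
      ≈⟨ +-cong ([1-x]^-coeff-neg a m) (sym ([1-x]^-suc -[1+ a ] (suc m))) ⟩
    ((a ℕ.+ m) C m) · 1# + ([1-x]^ ℤ.suc -[1+ a ]) (suc m) ≈⟨ next a ⟩
    ((a ℕ.+ suc m) C suc m) · 1#                         ∎
    where
    uncancel : ∀ f → f (suc m) ≈ f m + (L *ₛ f) (suc m)
    uncancel f = begin
      f (suc m)                    ≈⟨ +-identityˡ _ ⟨
      0# + f (suc m)               ≈⟨ +-congʳ (-‿inverseʳ (f m)) ⟨
      f m - f m + f (suc m)        ≈⟨ solve 3 (λ x y z → x :+ y :+ z := x :+ (z :+ y)) refl _ _ _ ⟩
      f m + (f (suc m) - f m)      ≈⟨ +-congˡ (L*-suc f m) ⟨
      f m + (L *ₛ f) (suc m)       ∎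
    next : ∀ a → ((a ℕ.+ m) C m) · 1# + ([1-x]^ ℤ.suc -[1+ a ]) (suc m) ≈ ((a ℕ.+ suc m) C suc m) · 1#
    next zero    = trans (+-identityʳ _)
      (reflexive (≡.cong (_· 1#) (≡.trans (nCn≡1 m) (≡.sym (nCn≡1 (suc m))))))
    next (suc a) = begin
      ((suc a ℕ.+ m) C m) · 1# + ([1-x]^ -[1+ a ]) (suc m)      ≈⟨ +-congˡ ([1-x]^-coeff-neg a (suc m)) ⟩
      ((suc a ℕ.+ m) C m) · 1# + ((a ℕ.+ suc m) C suc m) · 1#
        ≡⟨ ≡.cong (λ k → (k C m) · 1# + ((a ℕ.+ suc m) C suc m) · 1#) (≡.sym (ℕₚ.+-suc a m)) ⟩
      ((a ℕ.+ suc m) C m) · 1# + ((a ℕ.+ suc m) C suc m) · 1#   ≈⟨ pascal (a ℕ.+ suc m) m ⟩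
      ((suc a ℕ.+ suc m) C suc m) · 1#                          ∎

  -- This is upper negation of binomial coefficients, with p = m - w - 1 required to be a natural
  -- number. For negative `w` it is the negative binomial series; for w ≥ 0 both `w` and `p` lie
  -- below `m`, and both sides are zero. In the recurrence p = n + r - 1 is the same for all
  -- summands.
  [1-x]^-coeff : ∀ w p m → w ℤ.+ + suc p ≡ + m → ([1-x]^ w) m ≈ (p C m) · 1#
  [1-x]^-coeff (+ a) p m eq = begin
    ([1-x]^ (+ a)) m       ≈⟨ [1-x]^-coeff-+ a m ⟩
    sgn m * ((a C m) · 1#) ≡⟨ ≡.cong (λ k → sgn m * (k · 1#)) (k>n⇒nCk≡0 a<m) ⟩
    sgn m * 0#             ≈⟨ zeroʳ _ ⟩
    0#                     ≡⟨ ≡.cong (_· 1#) (≡.sym (k>n⇒nCk≡0 p<m)) ⟩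
    (p C m) · 1#           ∎
    where
    a+1+p≡m : a ℕ.+ suc p ≡ m
    a+1+p≡m = ℤₚ.+-injective eq
    a<m : a ℕ.< m
    a<m = ≡.subst (suc a ℕ.≤_) (≡.trans (≡.sym (ℕₚ.+-suc a p)) a+1+p≡m) (s≤s (ℕₚ.m≤m+n a p))
    p<m : p ℕ.< m
    p<m = ≡.subst (suc p ℕ.≤_) a+1+p≡m (ℕₚ.m≤n+m (suc p) a)
  [1-x]^-coeff -[1+ a ] p m eq = trans ([1-x]^-coeff-neg a m)
    (reflexive (≡.cong (λ k → (k C m) · 1#) (ℕₚ.suc-injective (ℤₚ.+-injective 1+a+m≡1+p))))
    where
    1+a+m≡1+p : + suc (a ℕ.+ m) ≡ + suc p
    1+a+m≡1+p = ≡.trans (≡.cong (ℤ._+_ (+ suc a)) (≡.sym eq)) (cancel (+ suc a) (+ suc p))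
      where
      cancel : ∀ x y → x ℤ.+ (ℤ.- x ℤ.+ y) ≡ y
      cancel = solve-∀

-- Parity, and even and odd parts of series.

dbl : ℕ → ℕ
dbl zero    = zero
dbl (suc n) = suc (suc (dbl n))

dbl≡2* : ∀ n → dbl n ≡ 2 ℕ.* n
dbl≡2* zero    = ≡.refl
dbl≡2* (suc n) = ≡.cong suc (≡.trans (≡.cong suc (dbl≡2* n)) (≡.sym (ℕₚ.+-suc n (n ℕ.+ 0))))

dbl-∸ : ∀ m n → dbl m ∸ dbl n ≡ dbl (m ∸ n)
dbl-∸ m       zero    = ≡.refl
dbl-∸ zero    (suc n) = ≡.refl
dbl-∸ (suc m) (suc n) = dbl-∸ m n

parity : ∀ n → (∃[ m ] n ≡ dbl m) ⊎ (∃[ m ] n ≡ suc (dbl m))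
parity zero = inj₁ (0 , ≡.refl)
parity (suc n) with parity n
... | inj₁ (m , n≡2m)   = inj₂ (m , ≡.cong suc n≡2m)
... | inj₂ (m , n≡2m+1) = inj₁ (suc m , ≡.cong suc n≡2m+1)

module Parts {c ℓ : Level} (R : CommutativeRing c ℓ) where

  open CommutativeRing R
  open PowerSeries R
  open SeriesRing R
  open RingProperties ring
  open SetoidReasoning setoid

  -- Alternating recursion avoids any parity test. Together with the recursive doubling `dbl` it
  -- makes the values at `dbl m` and `suc (dbl m)` provable as propositional equalities.
  evenPart oddPart : Series → Series
  evenPart f zero    = f 0
  evenPart f (suc n) = oddPart (f ∘ suc) n
  oddPart f zero    = 0#
  oddPart f (suc n) = evenPart (f ∘ suc) n

  evenPart-dbl : ∀ f m → evenPart f (dbl m) ≡ f (dbl m)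
  evenPart-dbl f zero    = ≡.refl
  evenPart-dbl f (suc m) = evenPart-dbl (f ∘ suc ∘ suc) m

  evenPart-suc-dbl : ∀ f m → evenPart f (suc (dbl m)) ≡ 0#
  evenPart-suc-dbl f zero    = ≡.refl
  evenPart-suc-dbl f (suc m) = evenPart-suc-dbl (f ∘ suc ∘ suc) m

  oddPart-dbl : ∀ f m → oddPart f (dbl m) ≡ 0#
  oddPart-dbl f zero    = ≡.refl
  oddPart-dbl f (suc m) = oddPart-dbl (f ∘ suc ∘ suc) m

  oddPart-suc-dbl : ∀ f m → oddPart f (suc (dbl m)) ≡ f (suc (dbl m))
  oddPart-suc-dbl f m = evenPart-dbl (f ∘ suc) m

  sgn-dbl : ∀ m → sgn (dbl m) ≈ 1#
  sgn-dbl zero    = refl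
  sgn-dbl (suc m) = trans (-‿involutive _) (sgn-dbl m)

  evenPart+oddPart : ∀ f → f ≈ₛ evenPart f +ₛ oddPart f
  evenPart+oddPart f zero    = sym (+-identityʳ (f 0))
  evenPart+oddPart f (suc n) = trans (evenPart+oddPart (f ∘ suc) n) (+-comm _ _)

  -- G(-t) is the even part minus the odd part. The odd part is moved to the left so that later
  -- identities contain no subtraction and the semiring solver can treat them.
  ᵒ+oddPart : ∀ f → f ᵒ +ₛ oddPart f ≈ₛ evenPart f
  ᵒ+oddPart f n with parity n
  ... | inj₁ (m , ≡.refl) = begin
    sgn (dbl m) * f (dbl m) + oddPart f (dbl m)
      ≈⟨ +-cong (trans (*-congʳ (sgn-dbl m)) (*-identityˡ _)) (reflexive (oddPart-dbl f m)) ⟩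
    f (dbl m) + 0#      ≈⟨ +-identityʳ _ ⟩
    f (dbl m)           ≡⟨ evenPart-dbl f m ⟨
    evenPart f (dbl m)  ∎
  ... | inj₂ (m , ≡.refl) = begin
    - sgn (dbl m) * f (suc (dbl m)) + oddPart f (suc (dbl m))
      ≈⟨ +-cong (trans (*-congʳ (-‿cong (sgn-dbl m))) (-1*x≈-x _)) (reflexive (oddPart-suc-dbl f m)) ⟩
    - f (suc (dbl m)) + f (suc (dbl m))  ≈⟨ -‿inverseˡ _ ⟩
    0#                                   ≡⟨ evenPart-suc-dbl f m ⟨
    evenPart f (suc (dbl m))             ∎

  oddPart-ᵒ : ∀ f → (oddPart f) ᵒ ≈ₛ -ₛ oddPart f
  oddPart-ᵒ f n with parity n
  ... | inj₁ (m , ≡.refl) rewrite oddPart-dbl f m = trans (zeroʳ _) (sym -0#≈0#)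
  ... | inj₂ (m , ≡.refl) = trans (*-congʳ (-‿cong (sgn-dbl m))) (-1*x≈-x _)

  Σ<-dbl : ∀ n (f : ℕ → Carrier) → Σ< (dbl n) f ≈ Σ< n (λ j → f (dbl j) + f (suc (dbl j)))
  Σ<-dbl zero    f = refl
  Σ<-dbl (suc n) f = trans (sym (+-assoc _ _ _)) (+-congˡ (Σ<-dbl n (f ∘ suc ∘ suc)))

  -- Agreement up to degree `n` survives multiplication by a fixed series. Through this, equations
  -- known only up to some degree can be multiplied by u or by its inverse.
  *ₛ-cong-≤ : ∀ f g h n → (∀ i → i ℕ.≤ n → g i ≈ h i) → (f *ₛ g) n ≈ (f *ₛ h) n
  *ₛ-cong-≤ f g h n g≈h = Σ<-cong (suc n) λ i → *-congˡ {f i} (g≈h (n ∸ i) (ℕₚ.m∸n≤m n i))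

-- The equation G(t) = e^t G(-t) and the series t coth(t/2).

module Bernoulli {c ℓ₁ ℓ₂ : Level} (K : HeytingField c ℓ₁ ℓ₂) (char0 : CharacteristicZero K) where

  open OverField K char0
  open CommutativeRing commutativeRing
  open SeriesRing commutativeRing
  open Parts commutativeRing
  open Fixed commutativeRing using (*-cancel-inverseˡ; module S; module SP; module SR; module SS)
  open RingProperties ring
  open SemiringSolver commutativeSemiring using (solve; _:=_; _:+_; _:*_)
  open SemiringMult semiring using (×-homo-+; ×1-homo-*)
  open SetoidReasoning setoid

  fromℕ-*-cancel : ∀ n x → fromℕ (suc n) * x ≈ 0# → x ≈ 0#
  fromℕ-*-cancel n x nx≈0 = begin
    x                                     ≈⟨ *-identityˡ x ⟨
    1# * x                                ≈⟨ *-congʳ (*-recip-suc n) ⟨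
    fromℕ (suc n) * recip +[1+ n ] * x
      ≈⟨ solve 3 (λ a b y → a :* b :* y := b :* (a :* y)) refl (fromℕ (suc n)) (recip +[1+ n ]) x ⟩
    recip +[1+ n ] * (fromℕ (suc n) * x)  ≈⟨ *-congˡ nx≈0 ⟩
    recip +[1+ n ] * 0#                   ≈⟨ zeroʳ _ ⟩
    0#                                    ∎

  x≈-x⇒x≈0 : ∀ x → x ≈ - x → x ≈ 0#
  x≈-x⇒x≈0 x x≈-x = fromℕ-*-cancel 1 x (begin
    fromℕ 2 * x                ≈⟨ *-congʳ (+-congˡ (+-identityʳ 1#)) ⟩
    (1# + 1#) * x              ≈⟨ distribʳ x 1# 1# ⟩
    1# * x + 1# * x            ≈⟨ +-cong (*-identityˡ x) (trans (*-identityˡ x) x≈-x) ⟩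
    x - x                      ≈⟨ -‿inverseʳ x ⟩
    0#                         ∎)

  exp-0 : exp 0 ≈ 1#
  exp-0 = begin
    exp 0            ≈⟨ *-identityˡ (exp 0) ⟨
    1# * exp 0       ≈⟨ *-congʳ (+-identityʳ 1#) ⟨
    fromℕ 1 * exp 0  ≈⟨ *-recip-! 0 ⟩
    1#               ∎

  exp-suc : ∀ n → fromℕ (suc n) * exp (suc n) ≈ exp n
  exp-suc n = begin
    fromℕ (suc n) * exp (suc n)                            ≈⟨ *-identityˡ _ ⟨
    1# * (fromℕ (suc n) * exp (suc n))                     ≈⟨ *-congʳ (*-recip-! n) ⟨
    fromℕ (n !) * exp n * (fromℕ (suc n) * exp (suc n))
      ≈⟨ solve 4 (λ a b x y → a :* x :* (b :* y) := x :* (b :* a :* y))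
           refl (fromℕ (n !)) (fromℕ (suc n)) (exp n) (exp (suc n)) ⟩
    exp n * (fromℕ (suc n) * fromℕ (n !) * exp (suc n))    ≈⟨ *-congˡ (*-congʳ (×1-homo-* (suc n) (n !))) ⟨
    exp n * (fromℕ (suc n !) * exp (suc n))                ≈⟨ *-congˡ (*-recip-! (suc n)) ⟩
    exp n * 1#                                             ≈⟨ *-identityʳ _ ⟩
    exp n                                                  ∎

  private
    u b : Series
    u = [exp-1]/t
    b = inverse u 1#

    u*b≈1 : u *ₛ b ≈ₛ 1ₛ
    u*b≈1 = *-inverse u 1# (trans (*-identityʳ (exp 1)) exp-0)

    exp≈1+xu : exp ≈ₛ 1ₛ +ₛ X *ₛ u
    exp≈1+xu zero    = trans exp-0 (sym (trans (+-congˡ (X*-zero u)) (+-identityʳ 1#)))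
    exp≈1+xu (suc n) = sym (trans (+-identityˡ _) (X*-suc u n))

    -- The Euler operator t d/dt. Unlike d/dt it preserves degrees, so the product rule holds
    -- summand by summand without a shift of indices.
    θ : Series → Series
    θ f n = fromℕ n * f n

    θ-* : ∀ f g → θ (f *ₛ g) ≈ₛ θ f *ₛ g +ₛ f *ₛ θ g
    θ-* f g n = begin
      fromℕ n * (f *ₛ g) n
        ≈⟨ Σ<-*ˡ (suc n) (fromℕ n) (λ i → f i * g (n ∸ i)) ⟩
      Σ< (suc n) (λ i → fromℕ n * (f i * g (n ∸ i)))
        ≈⟨ Σ<-cong-< (suc n) (λ { i (s≤s i≤n) → split i i≤n }) ⟩
      Σ< (suc n) (λ i → θ f i * g (n ∸ i) + f i * θ g (n ∸ i))
        ≈⟨ Σ<-+ (suc n) (λ i → θ f i * g (n ∸ i)) (λ i → f i * θ g (n ∸ i)) ⟩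
      (θ f *ₛ g +ₛ f *ₛ θ g) n ∎
      where
      split : ∀ i → i ℕ.≤ n → fromℕ n * (f i * g (n ∸ i)) ≈ θ f i * g (n ∸ i) + f i * θ g (n ∸ i)
      split i i≤n = begin
        fromℕ n * (f i * g (n ∸ i))
          ≡⟨ ≡.cong (λ k → fromℕ k * (f i * g (n ∸ i))) (≡.sym (ℕₚ.m+[n∸m]≡n i≤n)) ⟩
        fromℕ (i ℕ.+ (n ∸ i)) * (f i * g (n ∸ i))
          ≈⟨ *-congʳ (×-homo-+ 1# i (n ∸ i)) ⟩
        (fromℕ i + fromℕ (n ∸ i)) * (f i * g (n ∸ i))
          ≈⟨ solve 4 (λ p q x y → (p :+ q) :* (x :* y) := p :* x :* y :+ x :* (q :* y))
               refl (fromℕ i) (fromℕ (n ∸ i)) (f i) (g (n ∸ i)) ⟩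
        θ f i * g (n ∸ i) + f i * θ g (n ∸ i) ∎

    θ-exp : θ exp ≈ₛ X *ₛ exp
    θ-exp zero    = trans (zeroˡ _) (sym (X*-zero exp))
    θ-exp (suc n) = trans (exp-suc n) (sym (X*-suc exp n))

    θ-expᵒ : θ (exp ᵒ) ≈ₛ -ₛ (X *ₛ exp ᵒ)
    θ-expᵒ zero    = trans (zeroˡ _) (sym (trans (-‿cong (X*-zero (exp ᵒ))) -0#≈0#))
    θ-expᵒ (suc n) = begin
      fromℕ (suc n) * (- sgn n * exp (suc n))
        ≈⟨ solve 3 (λ a x y → a :* (x :* y) := x :* (a :* y)) refl (fromℕ (suc n)) (- sgn n) (exp (suc n)) ⟩
      - sgn n * (fromℕ (suc n) * exp (suc n))  ≈⟨ *-congˡ (exp-suc n) ⟩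
      - sgn n * exp n                          ≈⟨ -‿distribˡ-* _ _ ⟨
      - (sgn n * exp n)                        ≈⟨ -‿cong (X*-suc (exp ᵒ) n) ⟨
      - (X *ₛ exp ᵒ) (suc n)                   ∎

    -- The Euler operator annihilates e^t e^(-t), and in characteristic zero a series that it
    -- annihilates is constant. This replaces the alternating sum of binomial coefficients.
    exp*expᵒ≈1 : exp *ₛ exp ᵒ ≈ₛ 1ₛ
    exp*expᵒ≈1 zero    = begin
      exp 0 * (1# * exp 0) + 0#  ≈⟨ +-identityʳ _ ⟩
      exp 0 * (1# * exp 0)       ≈⟨ *-cong exp-0 (trans (*-identityˡ _) exp-0) ⟩
      1# * 1#                    ≈⟨ *-identityˡ 1# ⟩
      1#                         ∎
    exp*expᵒ≈1 (suc n) = fromℕ-*-cancel n _ (constant (suc n))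
      where
      constant : θ (exp *ₛ exp ᵒ) ≈ₛ 0ₛ
      constant = SR.begin
        θ (exp *ₛ exp ᵒ)                                       SR.≈⟨ θ-* exp (exp ᵒ) ⟩
        θ exp *ₛ exp ᵒ +ₛ exp *ₛ θ (exp ᵒ)
          SR.≈⟨ S.+-cong (S.*-congʳ {exp ᵒ} θ-exp) (S.*-congˡ {exp} θ-expᵒ) ⟩
        X *ₛ exp *ₛ exp ᵒ +ₛ exp *ₛ (-ₛ (X *ₛ exp ᵒ))
          SR.≈⟨ S.+-congˡ {X *ₛ exp *ₛ exp ᵒ} (S.sym (SP.-‿distribʳ-* exp (X *ₛ exp ᵒ))) ⟩
        X *ₛ exp *ₛ exp ᵒ +ₛ (-ₛ (exp *ₛ (X *ₛ exp ᵒ)))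
          SR.≈⟨ S.+-congʳ {(-ₛ (exp *ₛ (X *ₛ exp ᵒ)))} (SS.solve 3 (λ x e f → (x SS.:* e) SS.:* f SS.:= e SS.:* (x SS.:* f))
               S.refl X exp (exp ᵒ)) ⟩
        exp *ₛ (X *ₛ exp ᵒ) +ₛ (-ₛ (exp *ₛ (X *ₛ exp ᵒ)))      SR.≈⟨ S.-‿inverseʳ (exp *ₛ (X *ₛ exp ᵒ)) ⟩
        0ₛ                                                     SR.∎

    expᵒ+xuᵒ≈1 : exp ᵒ +ₛ X *ₛ u ᵒ ≈ₛ 1ₛ
    expᵒ+xuᵒ≈1 zero    = begin
      1# * exp 0 + (X *ₛ u ᵒ) 0  ≈⟨ +-cong (trans (*-identityˡ _) exp-0) (X*-zero (u ᵒ)) ⟩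
      1# + 0#                    ≈⟨ +-identityʳ 1# ⟩
      1#                         ∎
    expᵒ+xuᵒ≈1 (suc n) = begin
      - sgn n * exp (suc n) + (X *ₛ u ᵒ) (suc n)  ≈⟨ +-cong (sym (-‿distribˡ-* _ _)) (X*-suc (u ᵒ) n) ⟩
      - (sgn n * exp (suc n)) + sgn n * exp (suc n)  ≈⟨ -‿inverseˡ _ ⟩
      0#                                          ∎

    -- As u = (e^t - 1)/t, one has u(-t) = (1 - e^(-t))/t, and multiplication by e^t gives u back.
    -- Adding 1 after multiplying by t turns both sides into e^t without a division.
    exp*uᵒ≈u : exp *ₛ u ᵒ ≈ₛ u
    exp*uᵒ≈u = X*-cancel {exp *ₛ u ᵒ} {u} (SP.+-cancelˡ 1ₛ (X *ₛ (exp *ₛ u ᵒ)) (X *ₛ u) (SR.begin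
      1ₛ +ₛ X *ₛ (exp *ₛ u ᵒ)              SR.≈⟨ S.+-congʳ {X *ₛ (exp *ₛ u ᵒ)} exp*expᵒ≈1 ⟨
      exp *ₛ exp ᵒ +ₛ X *ₛ (exp *ₛ u ᵒ)
        SR.≈⟨ SS.solve 4 (λ e f x v → e SS.:* f SS.:+ x SS.:* (e SS.:* v) SS.:= e SS.:* (f SS.:+ x SS.:* v))
             S.refl exp (exp ᵒ) X (u ᵒ) ⟩
      exp *ₛ (exp ᵒ +ₛ X *ₛ u ᵒ)           SR.≈⟨ S.*-congˡ {exp} expᵒ+xuᵒ≈1 ⟩
      exp *ₛ 1ₛ                            SR.≈⟨ *ₛ-identityʳ exp ⟩
      exp                                  SR.≈⟨ exp≈1+xu ⟩
      1ₛ +ₛ X *ₛ u                         SR.∎))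

    -- t coth (t/2)
    coth : Series
    coth = b +ₛ b +ₛ X

    u*coth≈1+exp : u *ₛ coth ≈ₛ 1ₛ +ₛ exp
    u*coth≈1+exp = SR.begin
      u *ₛ (b +ₛ b +ₛ X)
        SR.≈⟨ SS.solve 3 (λ v w x → v SS.:* (w SS.:+ w SS.:+ x) SS.:= v SS.:* w SS.:+ (v SS.:* w SS.:+ x SS.:* v))
             S.refl u b X ⟩
      u *ₛ b +ₛ (u *ₛ b +ₛ X *ₛ u)    SR.≈⟨ S.+-cong u*b≈1 (S.+-congʳ {X *ₛ u} u*b≈1) ⟩
      1ₛ +ₛ (1ₛ +ₛ X *ₛ u)            SR.≈⟨ S.+-congˡ {1ₛ} exp≈1+xu ⟨
      1ₛ +ₛ exp                       SR.∎

    b*[u*-] : ∀ f → b *ₛ (u *ₛ f) ≈ₛ f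
    b*[u*-] f = *-cancel-inverseˡ b u f (S.trans (*ₛ-comm b u) u*b≈1)

    -- After multiplication by u = e^t u(-t), both sides become e^t + 1, and u is invertible. This
    -- contains the vanishing of the Bernoulli numbers of odd index above 1; the summand `X` of
    -- `coth` compensates B₁ = -1/2.
    cothᵒ≈coth : coth ᵒ ≈ₛ coth
    cothᵒ≈coth = SR.begin
      coth ᵒ                 SR.≈⟨ b*[u*-] (coth ᵒ) ⟨
      b *ₛ (u *ₛ coth ᵒ)     SR.≈⟨ S.*-congˡ {b} u*cothᵒ≈u*coth ⟩
      b *ₛ (u *ₛ coth)       SR.≈⟨ b*[u*-] coth ⟩
      coth                   SR.∎
      where
      [1+exp]ᵒ : (1ₛ +ₛ exp) ᵒ ≈ₛ 1ₛ +ₛ exp ᵒ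
      [1+exp]ᵒ zero    = trans (distribˡ 1# 1# (exp 0)) (+-congʳ (*-identityˡ 1#))
      [1+exp]ᵒ (suc n) = trans (distribˡ (sgn (suc n)) 0# (exp (suc n))) (+-congʳ (zeroʳ _))
      u*cothᵒ≈u*coth : u *ₛ coth ᵒ ≈ₛ u *ₛ coth
      u*cothᵒ≈u*coth = SR.begin
        u *ₛ coth ᵒ                 SR.≈⟨ S.*-congʳ {coth ᵒ} exp*uᵒ≈u ⟨
        exp *ₛ u ᵒ *ₛ coth ᵒ        SR.≈⟨ *ₛ-assoc exp (u ᵒ) (coth ᵒ) ⟩
        exp *ₛ (u ᵒ *ₛ coth ᵒ)      SR.≈⟨ S.*-congˡ {exp} (ᵒ-* u coth) ⟨
        exp *ₛ (u *ₛ coth) ᵒ        SR.≈⟨ S.*-congˡ {exp} (λ n → *-congˡ (u*coth≈1+exp n)) ⟩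
        exp *ₛ (1ₛ +ₛ exp) ᵒ        SR.≈⟨ S.*-congˡ {exp} [1+exp]ᵒ ⟩
        exp *ₛ (1ₛ +ₛ exp ᵒ)        SR.≈⟨ *ₛ-distribˡ exp 1ₛ (exp ᵒ) ⟩
        exp *ₛ 1ₛ +ₛ exp *ₛ exp ᵒ   SR.≈⟨ S.+-cong (*ₛ-identityʳ exp) exp*expᵒ≈1 ⟩
        exp +ₛ 1ₛ                   SR.≈⟨ S.+-comm exp 1ₛ ⟩
        1ₛ +ₛ exp                   SR.≈⟨ u*coth≈1+exp ⟨
        u *ₛ coth                   SR.∎

    coth-dbl : ∀ m → coth (dbl m) ≈ fromℕ 2 * b (dbl m)
    coth-dbl m = begin
      b (dbl m) + b (dbl m) + X (dbl m)  ≈⟨ +-congˡ (X-dbl m) ⟩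
      b (dbl m) + b (dbl m) + 0#         ≈⟨ +-identityʳ _ ⟩
      b (dbl m) + b (dbl m)              ≈⟨ +-cong (*-identityˡ _) (*-identityˡ _) ⟨
      1# * b (dbl m) + 1# * b (dbl m)    ≈⟨ distribʳ _ 1# 1# ⟨
      (1# + 1#) * b (dbl m)              ≈⟨ *-congʳ (+-congˡ (+-identityʳ 1#)) ⟨
      fromℕ 2 * b (dbl m)                ∎
      where
      X-dbl : ∀ m → X (dbl m) ≈ 0#
      X-dbl zero    = refl
      X-dbl (suc m) = refl

    coth*odd-dbl : ∀ G m → (coth *ₛ oddPart G) (dbl m) ≈ 0#
    coth*odd-dbl G m = x≈-x⇒x≈0 _ (begin
      (coth *ₛ oddPart G) (dbl m)                  ≈⟨ trans (*-congʳ (sgn-dbl m)) (*-identityˡ _) ⟨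
      ((coth *ₛ oddPart G) ᵒ) (dbl m)              ≈⟨ ᵒ-* coth (oddPart G) (dbl m) ⟩
      (coth ᵒ *ₛ (oddPart G) ᵒ) (dbl m)            ≈⟨ *ₛ-cong cothᵒ≈coth (oddPart-ᵒ G) (dbl m) ⟩
      (coth *ₛ (-ₛ oddPart G)) (dbl m)             ≈⟨ SP.-‿distribʳ-* coth (oddPart G) (dbl m) ⟨
      - (coth *ₛ oddPart G) (dbl m)                ∎)

    coth*odd-suc-dbl : ∀ G m → (coth *ₛ oddPart G) (suc (dbl m)) ≈
      Σ< (suc m) λ j → G (suc (dbl j)) * (fromℕ 2 * b (dbl (m ∸ j)))
    coth*odd-suc-dbl G m = begin
      (coth *ₛ oddPart G) (suc (dbl m))
        ≈⟨ *ₛ-comm coth (oddPart G) (suc (dbl m)) ⟩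
      Σ< (dbl (suc m)) (λ i → oddPart G i * coth (suc (dbl m) ∸ i))
        ≈⟨ Σ<-dbl (suc m) (λ i → oddPart G i * coth (suc (dbl m) ∸ i)) ⟩
      Σ< (suc m) (λ j → oddPart G (dbl j) * coth (suc (dbl m) ∸ dbl j) + oddPart G (suc (dbl j)) * coth (dbl m ∸ dbl j))
        ≈⟨ Σ<-cong (suc m) (λ j → trans
             (+-cong (trans (*-congʳ {coth (suc (dbl m) ∸ dbl j)} (reflexive (oddPart-dbl G j))) (zeroˡ _))
                     (*-cong (reflexive (oddPart-suc-dbl G j))
                             (trans (reflexive (≡.cong coth (dbl-∸ m j))) (coth-dbl (m ∸ j)))))
             (+-identityˡ _)) ⟩
      Σ< (suc m) (λ j → G (suc (dbl j)) * (fromℕ 2 * b (dbl (m ∸ j))))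
        ∎

    -- exp·G(-t) - G = u·(t·even - coth·odd), without subtraction.
    defect : ∀ G → exp *ₛ G ᵒ +ₛ u *ₛ (coth *ₛ oddPart G) ≈ₛ G +ₛ u *ₛ (X *ₛ evenPart G)
    defect G = SR.begin
      exp *ₛ G ᵒ +ₛ u *ₛ (coth *ₛ O)
        SR.≈⟨ S.+-congˡ {exp *ₛ G ᵒ} (S.trans (S.sym (*ₛ-assoc u coth O)) (S.*-congʳ {O} u*coth≈1+exp)) ⟩
      exp *ₛ G ᵒ +ₛ (1ₛ +ₛ exp) *ₛ O
        SR.≈⟨ SS.solve 3 (λ e g o → e SS.:* g SS.:+ (SS.con 1 SS.:+ e) SS.:* o SS.:= e SS.:* (g SS.:+ o) SS.:+ o)
             S.refl exp (G ᵒ) O ⟩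
      exp *ₛ (G ᵒ +ₛ O) +ₛ O
        SR.≈⟨ S.+-congʳ {O} (*ₛ-cong exp≈1+xu (ᵒ+oddPart G)) ⟩
      (1ₛ +ₛ X *ₛ u) *ₛ P +ₛ O
        SR.≈⟨ SS.solve 4 (λ x v p o → (SS.con 1 SS.:+ x SS.:* v) SS.:* p SS.:+ o SS.:= (p SS.:+ o) SS.:+ v SS.:* (x SS.:* p))
             S.refl X u P O ⟩
      (P +ₛ O) +ₛ u *ₛ (X *ₛ P)
        SR.≈⟨ S.+-congʳ {u *ₛ (X *ₛ P)} (evenPart+oddPart G) ⟨
      G +ₛ u *ₛ (X *ₛ P)
        SR.∎
      where
      P O : Series
      P = evenPart G
      O = oddPart G

  -- Equivalently, e^(-t/2) G(t) is even.
  HalfShiftEven : Series → ℕ → Set ℓ₁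
  HalfShiftEven G n = G n ≈ (exp *ₛ G ᵒ) n

  -- The coefficient of t^(2m+1) in t even(G) = t coth(t/2) odd(G).
  OddDeterminesEven : Series → ℕ → Set ℓ₁
  OddDeterminesEven G m =
    G (dbl m) ≈ Σ< (suc m) λ j → G (suc (dbl j)) * (fromℕ 2 * inverse [exp-1]/t 1# (dbl (m ∸ j)))

  -- Cancelling G in `defect` leaves u coth odd = u t even up to degree N, and multiplication by 1/u
  -- removes u. The relation for `m` is read off at degree 2m+1, whence the bound on `m`.
  shift⇒bernoulli : ∀ G N → (∀ n → n ℕ.≤ N → HalfShiftEven G n) →
                    ∀ m → suc (dbl m) ℕ.≤ N → OddDeterminesEven G m
  shift⇒bernoulli G N shift m 2m+1≤N = begin
    G (dbl m)                            ≡⟨ evenPart-dbl G m ⟨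
    evenPart G (dbl m)                   ≈⟨ X*-suc (evenPart G) (dbl m) ⟨
    (X *ₛ evenPart G) (suc (dbl m))      ≈⟨ b*[u*-] (X *ₛ evenPart G) (suc (dbl m)) ⟨
    (b *ₛ (u *ₛ (X *ₛ evenPart G))) (suc (dbl m))
      ≈⟨ *ₛ-cong-≤ b (u *ₛ (coth *ₛ oddPart G)) (u *ₛ (X *ₛ evenPart G)) (suc (dbl m)) agree ⟨
    (b *ₛ (u *ₛ (coth *ₛ oddPart G))) (suc (dbl m))  ≈⟨ b*[u*-] (coth *ₛ oddPart G) (suc (dbl m)) ⟩
    (coth *ₛ oddPart G) (suc (dbl m))    ≈⟨ coth*odd-suc-dbl G m ⟩
    _                                    ∎
    where
    agree : ∀ i → i ℕ.≤ suc (dbl m) → (u *ₛ (coth *ₛ oddPart G)) i ≈ (u *ₛ (X *ₛ evenPart G)) i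
    agree i i≤2m+1 = +-cancelˡ (G i) _ _
      (trans (+-congʳ (shift i (ℕₚ.≤-trans i≤2m+1 2m+1≤N))) (defect G i))

  -- The relations make t even and coth odd agree up to degree N, and `defect` turns this into the
  -- functional equation. For even N the relations do not involve G N; this is the source of the
  -- free coefficient γ_(-r).
  bernoulli⇒shift : ∀ G N → (∀ m → suc (dbl m) ℕ.≤ N → OddDeterminesEven G m) →
                    ∀ n → n ℕ.≤ N → HalfShiftEven G n
  bernoulli⇒shift G N determined n n≤N = sym (+-cancelʳ ((u *ₛ (X *ₛ evenPart G)) n) _ _ (begin
    (exp *ₛ G ᵒ) n + (u *ₛ (X *ₛ evenPart G)) n
      ≈⟨ +-congˡ (*ₛ-cong-≤ u (coth *ₛ oddPart G) (X *ₛ evenPart G) n (λ i i≤n → agree i (ℕₚ.≤-trans i≤n n≤N))) ⟨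
    (exp *ₛ G ᵒ) n + (u *ₛ (coth *ₛ oddPart G)) n
      ≈⟨ defect G n ⟩
    G n + (u *ₛ (X *ₛ evenPart G)) n ∎))
    where
    X*even-dbl : ∀ m → (X *ₛ evenPart G) (dbl m) ≈ 0#
    X*even-dbl zero    = X*-zero (evenPart G)
    X*even-dbl (suc m) = trans (X*-suc (evenPart G) (suc (dbl m))) (reflexive (evenPart-suc-dbl G m))
    -- At even degrees both series vanish, so agreement at odd degrees is enough.
    agree : ∀ i → i ℕ.≤ N → (coth *ₛ oddPart G) i ≈ (X *ₛ evenPart G) i
    agree i i≤N with parity i
    ... | inj₁ (m , ≡.refl) = trans (coth*odd-dbl G m) (sym (X*even-dbl m))
    ... | inj₂ (m , ≡.refl) = begin
      (coth *ₛ oddPart G) (suc (dbl m))  ≈⟨ coth*odd-suc-dbl G m ⟩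
      _                                  ≈⟨ determined m i≤N ⟨
      G (dbl m)                          ≡⟨ evenPart-dbl G m ⟨
      evenPart G (dbl m)                 ≈⟨ X*-suc (evenPart G) (dbl m) ⟨
      (X *ₛ evenPart G) (suc (dbl m))    ∎

-- Factorial weights: from binomial sums to products of series.

pos-∸ : ∀ {m n} → n ℕ.≤ m → + (m ∸ n) ≡ + m ℤ.- + n
pos-∸ {m} {n} n≤m = ≡.sym (≡.trans (ℤₚ.m-n≡m⊖n m n) (ℤₚ.⊖-≥ n≤m))

pos-dbl : ∀ m → + dbl m ≡ + 2 ℤ.* + m
pos-dbl m = ≡.trans (≡.cong +_ (dbl≡2* m)) (ℤₚ.pos-* 2 m)

dbl-mono-≤ : ∀ {m n} → m ℕ.≤ n → dbl m ℕ.≤ dbl n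
dbl-mono-≤ z≤n       = z≤n
dbl-mono-≤ (s≤s m≤n) = s≤s (s≤s (dbl-mono-≤ m≤n))

nCk*k![n∸k]!≡n! : ∀ {n k} → k ℕ.≤ n → (n C k) ℕ.* (k ! ℕ.* (n ∸ k) !) ≡ n !
nCk*k![n∸k]!≡n! {n} {k} k≤n = ≡.trans
  (≡.cong (ℕ._* (k ! ℕ.* (n ∸ k) !)) (nCk≡n!/k![n-k]! k≤n))
  (m/n*n≡m {{ℕₚ._!*_!≢0 k (n ∸ k)}} (k![n∸k]!∣n! k≤n))

module Translation {c ℓ₁ ℓ₂ : Level} (K : HeytingField c ℓ₁ ℓ₂) (char0 : CharacteristicZero K) where

  open OverField K char0
  open CommutativeRing commutativeRing
  open SeriesRing commutativeRing
  open Parts commutativeRing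
  open Fixed commutativeRing
  open Bernoulli K char0
  open RingProperties ring
  open SemiringSolver commutativeSemiring using (solve; _:=_; _:+_; _:*_)
  open SemiringMult semiring using (×1-homo-*)
  open SetoidReasoning setoid

  fromℕ-C : ∀ {n k} → k ℕ.≤ n → fromℕ (n C k) ≈ fromℕ (n !) * (exp k * exp (n ∸ k))
  fromℕ-C {n} {k} k≤n = sym (begin
    fromℕ (n !) * (exp k * exp (n ∸ k))
      ≡⟨ ≡.cong (λ a → fromℕ a * (exp k * exp (n ∸ k))) (nCk*k![n∸k]!≡n! k≤n) ⟨
    fromℕ ((n C k) ℕ.* (k ! ℕ.* (n ∸ k) !)) * (exp k * exp (n ∸ k))
      ≈⟨ *-congʳ (trans (×1-homo-* (n C k) (k ! ℕ.* (n ∸ k) !)) (*-congˡ (×1-homo-* (k !) ((n ∸ k) !)))) ⟩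
    fromℕ (n C k) * (fromℕ (k !) * fromℕ ((n ∸ k) !)) * (exp k * exp (n ∸ k))
      ≈⟨ solve 5 (λ a x y x′ y′ → a :* (x :* y) :* (x′ :* y′) := a :* (x :* x′ :* (y :* y′))) refl
           (fromℕ (n C k)) (fromℕ (k !)) (fromℕ ((n ∸ k) !)) (exp k) (exp (n ∸ k)) ⟩
    fromℕ (n C k) * (fromℕ (k !) * exp k * (fromℕ ((n ∸ k) !) * exp (n ∸ k)))
      ≈⟨ *-congˡ (*-cong (*-recip-! k) (*-recip-! (n ∸ k))) ⟩
    fromℕ (n C k) * (1# * 1#)
      ≈⟨ *-congˡ (*-identityˡ 1#) ⟩
    fromℕ (n C k) * 1#
      ≈⟨ *-identityʳ _ ⟩
    fromℕ (n C k) ∎)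

  -- Every change of normalisation multiplies both sides of an equation by a factor `w` with inverse
  -- `v`; stating this once yields both directions of each translation.
  ≈-scale : ∀ v w {x y a b} → v * w ≈ 1# → x ≈ w * a → y ≈ w * b → (x ≈ y) ⇔ (a ≈ b)
  ≈-scale v w {x} {y} {a} {b} vw≈1 x≈wa y≈wb = mk⇔
    (λ x≈y → begin
      a            ≈⟨ unscale a ⟨
      v * (w * a)  ≈⟨ *-congˡ (trans (sym x≈wa) (trans x≈y y≈wb)) ⟩
      v * (w * b)  ≈⟨ unscale b ⟩
      b            ∎)
    (λ a≈b → trans x≈wa (trans (*-congˡ a≈b) (sym y≈wb)))
    where
    unscale : ∀ z → v * (w * z) ≈ z
    unscale z = trans (sym (*-assoc v w z)) (trans (*-congʳ vw≈1) (*-identityˡ z))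

  coeff-neg : ∀ γ {z} → z ℤ.< 0ℤ → coeff γ z ≈ 0#
  coeff-neg γ {+ n}      (ℤ.+<+ ())
  coeff-neg γ { -[1+ n ] } _ = refl

  -- Reversal of a sum is commutativity of the product with the all-ones series.
  Σ<-reverse : ∀ n f → Σ< (suc n) f ≈ Σ< (suc n) (λ d → f (n ∸ d))
  Σ<-reverse n f = begin
    Σ< (suc n) f                       ≈⟨ Σ<-cong (suc n) (λ i → sym (*-identityʳ (f i))) ⟩
    (f *ₛ (λ _ → 1#)) n                ≈⟨ *ₛ-comm f (λ _ → 1#) n ⟩
    ((λ _ → 1#) *ₛ f) n                ≈⟨ Σ<-cong (suc n) (λ d → *-identityˡ (f (n ∸ d))) ⟩
    Σ< (suc n) (λ d → f (n ∸ d))       ∎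

  -- The part of γ above degree -r, as an exponential generating function in
  -- which the coefficient γᵢ has index i + r - 1.
  upperEGF : Series → ℤ → Series
  upperEGF γ r a = coeff γ (+ suc a ℤ.- r) * exp a

  sgn-∸ : ∀ {d n} → d ℕ.≤ n → sgn n ≈ sgn d * sgn (n ∸ d)
  sgn-∸ {d} {n} d≤n = trans (reflexive (≡.cong sgn (≡.sym (ℕₚ.m+[n∸m]≡n d≤n)))) (sgn-+ d (n ∸ d))

  -- With d = n - i the binomial coefficient is C(p, d) = p! / (d! (p-d)!), so division by p! turns
  -- the recurrence into a product with e^t. The sign (-1)^(n-d) splits into (-1)^(n+p), which is
  -- constant in d, and (-1)^(p-d), which turns G(t) into G(-t).
  FixedAt-upper : ∀ γ r n p → + n ℤ.+ r ≡ + suc p →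
    FixedAt γ r n ⇔ (upperEGF γ r p ≈ sgn (n ℕ.+ p) * (exp *ₛ upperEGF γ r ᵒ) p)
  FixedAt-upper γ r n p n+r≡1+p = ≈-scale (exp p) (fromℕ (p !))
    (trans (*-comm _ _) (*-recip-! p)) lhs rhs
    where
    r≡ : r ≡ + suc p ℤ.- + n
    r≡ = ≡.trans (cancel (+ n) r) (≡.cong (ℤ._- + n) n+r≡1+p)
      where
      cancel : ∀ a b → b ≡ a ℤ.+ b ℤ.- a
      cancel = solve-∀

    index : ∀ {d} → d ℕ.≤ p → + suc (p ∸ d) ℤ.- r ≡ + n ℤ.- + d
    index {d} d≤p = ≡.trans
      (≡.cong₂ (λ a b → 1ℤ ℤ.+ a ℤ.- b) (pos-∸ d≤p) r≡) (identity (+ p) (+ n) (+ d))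
      where
      identity : ∀ a b e → 1ℤ ℤ.+ (a ℤ.- e) ℤ.- (1ℤ ℤ.+ a ℤ.- b) ≡ b ℤ.- e
      identity = solve-∀

    lhs : γ n ≈ fromℕ (p !) * (coeff γ (+ suc p ℤ.- r) * exp p)
    lhs = sym (begin
      fromℕ (p !) * (coeff γ (+ suc p ℤ.- r) * exp p)
        ≡⟨ ≡.cong (λ z → fromℕ (p !) * (coeff γ z * exp p)) (≡.trans (index {0} z≤n) (ℤₚ.+-identityʳ (+ n))) ⟩
      fromℕ (p !) * (γ n * exp p)
        ≈⟨ solve 3 (λ a b x → a :* (x :* b) := a :* b :* x) refl (fromℕ (p !)) (exp p) (γ n) ⟩
      fromℕ (p !) * exp p * γ n
        ≈⟨ trans (*-congʳ (*-recip-! p)) (*-identityˡ (γ n)) ⟩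
      γ n ∎)

    f g : ℕ → Carrier
    f i = γ i * (sgn i * ([1-x]^ (ℤ.- r ℤ.- + i)) (n ∸ i))
    g d = fromℕ (p !) * (sgn (n ℕ.+ p) * (exp d * (upperEGF γ r ᵒ) (p ∸ d)))

    f-C : ∀ {d} → d ℕ.≤ n → f (n ∸ d) ≈ γ (n ∸ d) * (sgn (n ∸ d) * fromℕ (p C d))
    f-C {d} d≤n = *-congˡ (*-congˡ (trans
      (reflexive (≡.cong ([1-x]^ (ℤ.- r ℤ.- + (n ∸ d))) (ℕₚ.m∸[m∸n]≡n d≤n)))
      ([1-x]^-coeff (ℤ.- r ℤ.- + (n ∸ d)) p d
        (≡.trans (≡.cong₂ (λ a b → ℤ.- a ℤ.- b ℤ.+ + suc p) r≡ (pos-∸ d≤n)) (identity (+ suc p) (+ n) (+ d))))))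
      where
      identity : ∀ a b e → ℤ.- (a ℤ.- b) ℤ.- (b ℤ.- e) ℤ.+ a ≡ e
      identity = solve-∀

    f≈g : ∀ d → d ℕ.< suc n → d ℕ.< suc p → f (n ∸ d) ≈ g d
    f≈g d (s≤s d≤n) (s≤s d≤p) = sym (begin
      fromℕ (p !) * (sgn (n ℕ.+ p) * (exp d * (sgn (p ∸ d) * (coeff γ (+ suc (p ∸ d) ℤ.- r) * exp (p ∸ d)))))
        ≡⟨ ≡.cong (λ z → fromℕ (p !) * (sgn (n ℕ.+ p) * (exp d * (sgn (p ∸ d) * (coeff γ z * exp (p ∸ d))))))
             (≡.trans (index d≤p) (≡.sym (pos-∸ d≤n))) ⟩
      fromℕ (p !) * (sgn (n ℕ.+ p) * (exp d * (sgn (p ∸ d) * (γ (n ∸ d) * exp (p ∸ d)))))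
        ≈⟨ solve 6 (λ a s x t y z → a :* (s :* (x :* (t :* (y :* z)))) := y :* (s :* t :* (a :* (x :* z)))) refl
             (fromℕ (p !)) (sgn (n ℕ.+ p)) (exp d) (sgn (p ∸ d)) (γ (n ∸ d)) (exp (p ∸ d)) ⟩
      γ (n ∸ d) * (sgn (n ℕ.+ p) * sgn (p ∸ d) * (fromℕ (p !) * (exp d * exp (p ∸ d))))
        ≈⟨ *-congˡ (*-cong sign (sym (fromℕ-C d≤p))) ⟩
      γ (n ∸ d) * (sgn (n ∸ d) * fromℕ (p C d))
        ≈⟨ f-C d≤n ⟨
      f (n ∸ d) ∎)
      where
      sign : sgn (n ℕ.+ p) * sgn (p ∸ d) ≈ sgn (n ∸ d)
      sign = begin
        sgn (n ℕ.+ p) * sgn (p ∸ d)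
          ≈⟨ *-congʳ (trans (sgn-+ n p) (*-cong (sgn-∸ d≤n) (sgn-∸ d≤p))) ⟩
        sgn d * sgn (n ∸ d) * (sgn d * sgn (p ∸ d)) * sgn (p ∸ d)
          ≈⟨ solve 3 (λ x y z → x :* y :* (x :* z) :* z := y :* (x :* x :* (z :* z)))
               refl (sgn d) (sgn (n ∸ d)) (sgn (p ∸ d)) ⟩
        sgn (n ∸ d) * (sgn d * sgn d * (sgn (p ∸ d) * sgn (p ∸ d)))
          ≈⟨ *-congˡ (trans (*-cong (sgn² d) (sgn² (p ∸ d))) (*-identityˡ 1#)) ⟩
        sgn (n ∸ d) * 1#  ≈⟨ *-identityʳ _ ⟩
        sgn (n ∸ d)       ∎

    -- The terms with d > p are those of degree i = n - d ≤ -r; here the upper half separates from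
    -- the lower one.
    f≈0 : ∀ d → d ℕ.< suc n → suc p ℕ.≤ d → f (n ∸ d) ≈ 0#
    f≈0 d (s≤s d≤n) p<d = begin
      f (n ∸ d)                                  ≈⟨ f-C d≤n ⟩
      γ (n ∸ d) * (sgn (n ∸ d) * fromℕ (p C d))
        ≡⟨ ≡.cong (λ k → γ (n ∸ d) * (sgn (n ∸ d) * fromℕ k)) (k>n⇒nCk≡0 p<d) ⟩
      γ (n ∸ d) * (sgn (n ∸ d) * 0#)             ≈⟨ trans (*-congˡ (zeroʳ _)) (zeroʳ _) ⟩
      0#                                         ∎

    -- For r > 1 the product has more terms than the recurrence; they carry coefficients of γ at
    -- negative degrees.
    g≈0 : ∀ d → d ℕ.< suc p → suc n ℕ.≤ d → g d ≈ 0#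
    g≈0 d (s≤s d≤p) n<d = begin
      g d
        ≈⟨ *-congˡ (*-congˡ (*-congˡ (*-congˡ (*-congʳ
             (trans (reflexive (≡.cong (coeff γ) (index d≤p))) (coeff-neg γ n-d<0)))))) ⟩
      fromℕ (p !) * (sgn (n ℕ.+ p) * (exp d * (sgn (p ∸ d) * (0# * exp (p ∸ d)))))
        ≈⟨ *-congˡ (*-congˡ (*-congˡ (trans (*-congˡ (zeroˡ _)) (zeroʳ _)))) ⟩
      fromℕ (p !) * (sgn (n ℕ.+ p) * (exp d * 0#))
        ≈⟨ trans (*-congˡ (trans (*-congˡ (zeroʳ _)) (zeroʳ _))) (zeroʳ _) ⟩
      0# ∎
      where
      n-d<0 : + n ℤ.- + d ℤ.< 0ℤ
      n-d<0 = ≡.subst (ℤ._< 0ℤ) (≡.sym (≡.trans (ℤₚ.m-n≡m⊖n n d) (ℤₚ.⊖-< n<d)))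
        (ℤₚ.neg-mono-< (ℤ.+<+ (ℕₚ.m<n⇒0<n∸m n<d)))

    rhs : Σ< (suc n) f ≈ fromℕ (p !) * (sgn (n ℕ.+ p) * (exp *ₛ upperEGF γ r ᵒ) p)
    rhs = begin
      Σ< (suc n) f                     ≈⟨ Σ<-reverse n f ⟩
      Σ< (suc n) (λ d → f (n ∸ d))     ≈⟨ Σ<-cong-length (suc n) (suc p) f≈g f≈0 g≈0 ⟩
      Σ< (suc p) g
        ≈⟨ Σ<-*ˡ (suc p) (fromℕ (p !)) (λ d → sgn (n ℕ.+ p) * (exp d * (upperEGF γ r ᵒ) (p ∸ d))) ⟨
      fromℕ (p !) * Σ< (suc p) (λ d → sgn (n ℕ.+ p) * (exp d * (upperEGF γ r ᵒ) (p ∸ d)))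
        ≈⟨ *-congˡ (Σ<-*ˡ (suc p) (sgn (n ℕ.+ p)) (λ d → exp d * (upperEGF γ r ᵒ) (p ∸ d))) ⟨
      fromℕ (p !) * (sgn (n ℕ.+ p) * (exp *ₛ upperEGF γ r ᵒ) p) ∎

  -- The part of γ up to degree s = -r; the sign makes it satisfy the same
  -- functional equation as upperEGF.  The values beyond s are irrelevant.
  lowerEGF : Series → ℕ → Series
  lowerEGF γ s i = sgn i * (fromℕ ((s ∸ i) !) * γ i)

  -- C(s-i, n-i) = (s-i)! / ((n-i)! (s-n)!): the first factorial is the weight of γᵢ, the second a
  -- coefficient of e^t, and the third depends on `n` alone. The signs (-1)^i and (-1)^(n-i) combine
  -- to (-1)^n, likewise constant in i.
  FixedAt-lower : ∀ γ s n → n ℕ.≤ s →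
    FixedAt γ (ℤ.- + s) n ⇔ HalfShiftEven (lowerEGF γ s) n
  FixedAt-lower γ s n n≤s = ≈-scale (sgn n * fromℕ ((s ∸ n) !)) (sgn n * exp (s ∸ n))
    unit lhs rhs
    where
    h : Series
    h i = fromℕ ((s ∸ i) !) * γ i

    unit : sgn n * fromℕ ((s ∸ n) !) * (sgn n * exp (s ∸ n)) ≈ 1#
    unit = begin
      sgn n * fromℕ ((s ∸ n) !) * (sgn n * exp (s ∸ n))
        ≈⟨ solve 3 (λ x y z → x :* y :* (x :* z) := x :* x :* (y :* z))
             refl (sgn n) (fromℕ ((s ∸ n) !)) (exp (s ∸ n)) ⟩
      sgn n * sgn n * (fromℕ ((s ∸ n) !) * exp (s ∸ n))
        ≈⟨ trans (*-cong (sgn² n) (*-recip-! (s ∸ n))) (*-identityˡ 1#) ⟩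
      1# ∎

    lhs : γ n ≈ sgn n * exp (s ∸ n) * (sgn n * (fromℕ ((s ∸ n) !) * γ n))
    lhs = sym (begin
      sgn n * exp (s ∸ n) * (sgn n * (fromℕ ((s ∸ n) !) * γ n))
        ≈⟨ solve 4 (λ x y z w → x :* z :* (x :* (y :* w)) := x :* y :* (x :* z) :* w)
             refl (sgn n) (fromℕ ((s ∸ n) !)) (exp (s ∸ n)) (γ n) ⟩
      sgn n * fromℕ ((s ∸ n) !) * (sgn n * exp (s ∸ n)) * γ n
        ≈⟨ trans (*-congʳ unit) (*-identityˡ (γ n)) ⟩
      γ n ∎)

    term : ∀ i → i ℕ.≤ n → γ i * (sgn i * ([1-x]^ (ℤ.- (ℤ.- + s) ℤ.- + i)) (n ∸ i)) ≈
                           sgn n * exp (s ∸ n) * (h i * exp (n ∸ i))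
    term i i≤n = begin
      γ i * (sgn i * ([1-x]^ (ℤ.- (ℤ.- + s) ℤ.- + i)) (n ∸ i))
        ≡⟨ ≡.cong (λ z → γ i * (sgn i * ([1-x]^ z) (n ∸ i)))
             (≡.trans (≡.cong (ℤ._- + i) (ℤₚ.neg-involutive (+ s))) (≡.sym (pos-∸ (ℕₚ.≤-trans i≤n n≤s)))) ⟩
      γ i * (sgn i * ([1-x]^ (+ (s ∸ i))) (n ∸ i))
        ≈⟨ *-congˡ (*-congˡ (trans ([1-x]^-coeff-+ (s ∸ i) (n ∸ i))
             (*-congˡ (trans (fromℕ-C (ℕₚ.∸-monoˡ-≤ i n≤s))
               (*-congˡ (*-congˡ (reflexive (≡.cong exp s∸i∸[n∸i])))))))) ⟩
      γ i * (sgn i * (sgn (n ∸ i) * (fromℕ ((s ∸ i) !) * (exp (n ∸ i) * exp (s ∸ n)))))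
        ≈⟨ solve 6 (λ a x y b p q → a :* (x :* (y :* (b :* (p :* q)))) := x :* y :* q :* (b :* a :* p)) refl
             (γ i) (sgn i) (sgn (n ∸ i)) (fromℕ ((s ∸ i) !)) (exp (n ∸ i)) (exp (s ∸ n)) ⟩
      sgn i * sgn (n ∸ i) * exp (s ∸ n) * (h i * exp (n ∸ i))
        ≈⟨ *-congʳ (*-congʳ (sym (sgn-∸ i≤n))) ⟩
      sgn n * exp (s ∸ n) * (h i * exp (n ∸ i)) ∎
      where
      s∸i∸[n∸i] : s ∸ i ∸ (n ∸ i) ≡ s ∸ n
      s∸i∸[n∸i] = ≡.trans (ℕₚ.∸-+-assoc s i (n ∸ i)) (≡.cong (s ∸_) (ℕₚ.m+[n∸m]≡n i≤n))

    rhs : Σ< (suc n) (λ i → γ i * (sgn i * ([1-x]^ (ℤ.- (ℤ.- + s) ℤ.- + i)) (n ∸ i))) ≈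
          sgn n * exp (s ∸ n) * (exp *ₛ lowerEGF γ s ᵒ) n
    rhs = begin
      Σ< (suc n) (λ i → γ i * (sgn i * ([1-x]^ (ℤ.- (ℤ.- + s) ℤ.- + i)) (n ∸ i)))
        ≈⟨ Σ<-cong-< (suc n) (λ { i (s≤s i≤n) → term i i≤n }) ⟩
      Σ< (suc n) (λ i → sgn n * exp (s ∸ n) * (h i * exp (n ∸ i)))
        ≈⟨ Σ<-*ˡ (suc n) (sgn n * exp (s ∸ n)) (λ i → h i * exp (n ∸ i)) ⟨
      sgn n * exp (s ∸ n) * (h *ₛ exp) n
        ≈⟨ *-congˡ (*ₛ-comm h exp n) ⟩
      sgn n * exp (s ∸ n) * (exp *ₛ h) n
        ≈⟨ *-congˡ (S.*-congˡ {exp} (ᵒ-involutive h) n) ⟨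
      sgn n * exp (s ∸ n) * (exp *ₛ lowerEGF γ s ᵒ) n ∎

  -- The right side of (∗) for r = 2k + ε after the substitution i = j - k, where m = n + k, suc q =
  -- 2n + r and ε + 2j = 2i + r; δ j stands for γ_(2i+1).
  StarSum : (ε q m : ℕ) → (ℕ → Carrier) → Carrier
  StarSum ε q m δ = fromℕ 2 * recip (+ suc q) *
    Σ< (suc m) λ j → fromℕ (suc q C (ε ℕ.+ dbl j)) * bernoulli (dbl (m ∸ j)) * δ j

  -- If a + d = q + 1, then C(q+1, a) B_d / (q+1) = q! (1/a!) (B_d/d!), so the two equations differ
  -- by the factor q!. The denominator 2n + r = q + 1 in (∗) arises because γ_(2n) has index q = 2n
  -- + r - 1 in `upperEGF` while γ_(2i+1) has index 2i + r.
  bernoulli-star : ∀ ε q m → suc q ≡ ε ℕ.+ dbl m → ∀ x δ →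
    (x * exp q ≈ Σ< (suc m) (λ j → δ j * exp (ε ℕ.+ dbl j) * (fromℕ 2 * inverse [exp-1]/t 1# (dbl (m ∸ j))))) ⇔
    (x ≈ StarSum ε q m δ)
  bernoulli-star ε q m 1+q≡ε+2m x δ = mk⇔ (Equivalence.from scaled) (Equivalence.to scaled)
    where
    b : Series
    b = inverse [exp-1]/t 1#

    term : ∀ j → j ℕ.≤ m →
      fromℕ 2 * recip (+ suc q) * (fromℕ (suc q C (ε ℕ.+ dbl j)) * bernoulli (dbl (m ∸ j)) * δ j) ≈
      fromℕ (q !) * (δ j * exp (ε ℕ.+ dbl j) * (fromℕ 2 * b (dbl (m ∸ j))))
    term j j≤m = begin
      fromℕ 2 * recip (+ suc q) * (fromℕ (suc q C k) * (fromℕ (d !) * b d) * δ j)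
        ≈⟨ *-congˡ (*-congʳ (*-congʳ (trans (fromℕ-C k≤1+q)
             (*-cong (×1-homo-* (suc q) (q !)) (*-congˡ (reflexive (≡.cong exp 1+q∸k≡d))))))) ⟩
      fromℕ 2 * recip (+ suc q) * (fromℕ (suc q) * fromℕ (q !) * (exp k * exp d) * (fromℕ (d !) * b d) * δ j)
        ≈⟨ solve 9 (λ two ri q+1 q! ek ed d! bd δj →
             two :* ri :* (q+1 :* q! :* (ek :* ed) :* (d! :* bd) :* δj) :=
             q+1 :* ri :* (d! :* ed) :* (q! :* (δj :* ek :* (two :* bd)))) refl
             (fromℕ 2) (recip (+ suc q)) (fromℕ (suc q)) (fromℕ (q !)) (exp k) (exp d) (fromℕ (d !)) (b d) (δ j) ⟩
      fromℕ (suc q) * recip (+ suc q) * (fromℕ (d !) * exp d) * (fromℕ (q !) * (δ j * exp k * (fromℕ 2 * b d)))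
        ≈⟨ *-congʳ (trans (*-cong (*-recip-suc q) (*-recip-! d)) (*-identityˡ 1#)) ⟩
      1# * (fromℕ (q !) * (δ j * exp k * (fromℕ 2 * b d)))
        ≈⟨ *-identityˡ _ ⟩
      fromℕ (q !) * (δ j * exp k * (fromℕ 2 * b d)) ∎
      where
      k d : ℕ
      k = ε ℕ.+ dbl j
      d = dbl (m ∸ j)
      k≤1+q : k ℕ.≤ suc q
      k≤1+q = ≡.subst (k ℕ.≤_) (≡.sym 1+q≡ε+2m) (ℕₚ.+-monoʳ-≤ ε (dbl-mono-≤ j≤m))
      1+q∸k≡d : suc q ∸ k ≡ d
      1+q∸k≡d = ≡.trans (≡.cong (_∸ k) 1+q≡ε+2m)
        (≡.trans (ℕₚ.[m+n]∸[m+o]≡n∸o ε (dbl m) (dbl j)) (dbl-∸ m j))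

    scaled : (x ≈ StarSum ε q m δ) ⇔
      (x * exp q ≈ Σ< (suc m) (λ j → δ j * exp (ε ℕ.+ dbl j) * (fromℕ 2 * b (dbl (m ∸ j)))))
    scaled = ≈-scale (exp q) (fromℕ (q !)) (trans (*-comm _ _) (*-recip-! q))
      (sym (begin
        fromℕ (q !) * (x * exp q)
          ≈⟨ solve 3 (λ a y e → a :* (y :* e) := a :* e :* y) refl (fromℕ (q !)) x (exp q) ⟩
        fromℕ (q !) * exp q * x     ≈⟨ trans (*-congʳ (*-recip-! q)) (*-identityˡ x) ⟩
        x                           ∎))
      (begin
        StarSum ε q m δ
          ≈⟨ Σ<-*ˡ (suc m) (fromℕ 2 * recip (+ suc q)) (λ j → fromℕ (suc q C (ε ℕ.+ dbl j)) * bernoulli (dbl (m ∸ j)) * δ j) ⟩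
        Σ< (suc m) (λ j → fromℕ 2 * recip (+ suc q) * (fromℕ (suc q C (ε ℕ.+ dbl j)) * bernoulli (dbl (m ∸ j)) * δ j))
          ≈⟨ Σ<-cong-< (suc m) (λ { j (s≤s j≤m) → term j j≤m }) ⟩
        Σ< (suc m) (λ j → fromℕ (q !) * (δ j * exp (ε ℕ.+ dbl j) * (fromℕ 2 * b (dbl (m ∸ j)))))
          ≈⟨ Σ<-*ˡ (suc m) (fromℕ (q !)) (λ j → δ j * exp (ε ℕ.+ dbl j) * (fromℕ 2 * b (dbl (m ∸ j)))) ⟨
        fromℕ (q !) * Σ< (suc m) (λ j → δ j * exp (ε ℕ.+ dbl j) * (fromℕ 2 * b (dbl (m ∸ j)))) ∎)

  -- The right side of (∗∗) for r = -s. Writing s - 2j as `suc (s ∸ suc (dbl j))` exhibits the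
  -- denominator as nonzero and shows the factorial weight of γ_(2j+1).
  StarStarSum : Series → (s m : ℕ) → Carrier
  StarStarSum γ s m = Σ< (suc m) λ j →
    fromℕ 2 * recip -[1+ s ∸ suc (dbl j) ] * fromℕ (suc (s ∸ suc (dbl j)) C (s ∸ dbl m)) *
    bernoulli (dbl (m ∸ j)) * γ (suc (dbl j))

  -- With q + 1 = s - 2j and e = s - 2m, the quotient C(q+1, e)/(q+1) equals q! / (e! (2m-2j)!).
  -- Here q! is the weight of γ_(2j+1) in `lowerEGF`, e! that of γ_(2m), and the sign of the
  -- negative denominator 2j + r is the sign that `lowerEGF` gives to odd degrees.
  bernoulli-starStar : ∀ γ s m → suc (dbl m) ℕ.≤ s →
    OddDeterminesEven (lowerEGF γ s) m ⇔ (γ (dbl m) ≈ StarStarSum γ s m)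
  bernoulli-starStar γ s m 2m<s = mk⇔ (Equivalence.from scaled) (Equivalence.to scaled)
    where
    b : Series
    b = inverse [exp-1]/t 1#

    e : ℕ
    e = s ∸ dbl m

    term : ∀ j → j ℕ.≤ m →
      fromℕ 2 * recip -[1+ s ∸ suc (dbl j) ] * fromℕ (suc (s ∸ suc (dbl j)) C e) * bernoulli (dbl (m ∸ j)) * γ (suc (dbl j)) ≈
      exp e * (lowerEGF γ s (suc (dbl j)) * (fromℕ 2 * b (dbl (m ∸ j))))
    term j j≤m = begin
      fromℕ 2 * - recip +[1+ q ] * fromℕ (suc q C e) * (fromℕ (d !) * b d) * γ i
        -- The negation becomes a factor -1, which the semiring solver can carry as an atom.
        ≈⟨ *-congʳ (*-congʳ (*-cong (*-congˡ (sym (-1*x≈-x _))) (trans (fromℕ-C e≤1+q)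
             (*-cong (×1-homo-* (suc q) (q !)) (*-congˡ (reflexive (≡.cong exp 1+q∸e≡d))))))) ⟩
      fromℕ 2 * (- 1# * recip +[1+ q ]) * (fromℕ (suc q) * fromℕ (q !) * (exp e * exp d)) * (fromℕ (d !) * b d) * γ i
        ≈⟨ solve 10 (λ two neg ri q+1 q! ee ed d! bd γi →
             two :* (neg :* ri) :* (q+1 :* q! :* (ee :* ed)) :* (d! :* bd) :* γi :=
             q+1 :* ri :* (d! :* ed) :* (ee :* (neg :* (q! :* γi) :* (two :* bd)))) refl
             (fromℕ 2) (- 1#) (recip +[1+ q ]) (fromℕ (suc q)) (fromℕ (q !)) (exp e) (exp d) (fromℕ (d !)) (b d) (γ i) ⟩
      fromℕ (suc q) * recip +[1+ q ] * (fromℕ (d !) * exp d) * (exp e * (- 1# * (fromℕ (q !) * γ i) * (fromℕ 2 * b d)))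
        ≈⟨ *-cong (trans (*-cong (*-recip-suc q) (*-recip-! d)) (*-identityˡ 1#))
                  (*-congˡ (*-congʳ (*-congʳ (-‿cong (sym (sgn-dbl j)))))) ⟩
      1# * (exp e * (lowerEGF γ s i * (fromℕ 2 * b d)))
        ≈⟨ *-identityˡ _ ⟩
      exp e * (lowerEGF γ s i * (fromℕ 2 * b d)) ∎
      where
      i q d : ℕ
      i = suc (dbl j)
      q = s ∸ suc (dbl j)
      d = dbl (m ∸ j)
      1+q≡s∸2j : suc q ≡ s ∸ dbl j
      1+q≡s∸2j = ≡.sym (ℕₚ.+-∸-assoc 1 (ℕₚ.≤-trans (s≤s (dbl-mono-≤ j≤m)) 2m<s))
      e≤1+q : e ℕ.≤ suc q
      e≤1+q = ≡.subst (e ℕ.≤_) (≡.sym 1+q≡s∸2j) (ℕₚ.∸-monoʳ-≤ s (dbl-mono-≤ j≤m))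
      1+q∸e≡d : suc q ∸ e ≡ d
      1+q∸e≡d = ≡.trans (≡.cong (_∸ e) (≡.trans 1+q≡s∸2j s∸2j≡)) (≡.trans (ℕₚ.m+n∸n≡m (dbl m ∸ dbl j) e) (dbl-∸ m j))
        where
        s∸2j≡ : s ∸ dbl j ≡ dbl m ∸ dbl j ℕ.+ e
        s∸2j≡ = ≡.trans (≡.cong (_∸ dbl j) (≡.sym (ℕₚ.m+[n∸m]≡n (ℕₚ.<⇒≤ 2m<s))))
          (ℕₚ.+-∸-comm e (dbl-mono-≤ j≤m))

    scaled : (γ (dbl m) ≈ StarStarSum γ s m) ⇔ OddDeterminesEven (lowerEGF γ s) m
    scaled = ≈-scale (fromℕ (e !)) (exp e) (*-recip-! e)
      (sym (begin
        exp e * (sgn (dbl m) * (fromℕ (e !) * γ (dbl m)))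
          ≈⟨ *-congˡ (trans (*-congʳ (sgn-dbl m)) (*-identityˡ _)) ⟩
        exp e * (fromℕ (e !) * γ (dbl m))
          ≈⟨ solve 3 (λ x y z → x :* (y :* z) := y :* x :* z) refl (exp e) (fromℕ (e !)) (γ (dbl m)) ⟩
        fromℕ (e !) * exp e * γ (dbl m)                    ≈⟨ trans (*-congʳ (*-recip-! e)) (*-identityˡ _) ⟩
        γ (dbl m)                                          ∎))
      (trans (Σ<-cong-< (suc m) λ { j (s≤s j≤m) → term j j≤m })
        (sym (Σ<-*ˡ (suc m) (exp e) (λ j → lowerEGF γ s (suc (dbl j)) * (fromℕ 2 * b (dbl (m ∸ j)))))))

-- Integer indices and the two ranges of degrees.

2n+1<0 : ∀ t → + 2 ℤ.* -[1+ t ] ℤ.+ 1ℤ ℤ.< 0ℤ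
2n+1<0 t = ≡.subst (ℤ._< 0ℤ) (≡.sym 2n+1≡) ℤ.-<+
  where
  identity : ∀ a → + 2 ℤ.* (ℤ.- (1ℤ ℤ.+ a)) ℤ.+ 1ℤ ≡ ℤ.- (1ℤ ℤ.+ + 2 ℤ.* a)
  identity = solve-∀
  2n+1≡ : + 2 ℤ.* -[1+ t ] ℤ.+ 1ℤ ≡ -[1+ dbl t ]
  2n+1≡ = ≡.trans (identity (+ t)) (≡.cong (λ z → ℤ.- (1ℤ ℤ.+ z)) (≡.sym (pos-dbl t)))

even≢odd : ∀ a b → + 2 ℤ.* a ≢ + 2 ℤ.* b ℤ.+ 1ℤ
even≢odd a b 2a≡2b+1 = 2*x≢1 ∣ a ℤ.- b ∣ (≡.trans (≡.sym (ℤₚ.abs-* (+ 2) (a ℤ.- b))) (≡.cong ∣_∣ 2[a-b]≡1))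
  where
  2*x≢1 : ∀ x → 2 ℕ.* x ≢ 1
  2*x≢1 zero    ()
  2*x≢1 (suc x) eq with ≡.trans (≡.sym (ℕₚ.+-suc x (x ℕ.+ 0))) (ℕₚ.suc-injective eq)
  ... | ()
  distrib : ∀ a b → + 2 ℤ.* (a ℤ.- b) ≡ + 2 ℤ.* a ℤ.- + 2 ℤ.* b
  distrib = solve-∀
  cancel : ∀ c → c ℤ.+ 1ℤ ℤ.- c ≡ 1ℤ
  cancel = solve-∀
  2[a-b]≡1 : + 2 ℤ.* (a ℤ.- b) ≡ 1ℤ
  2[a-b]≡1 = ≡.trans (distrib a b) (≡.trans (≡.cong (ℤ._- + 2 ℤ.* b) 2a≡2b+1) (cancel (+ 2 ℤ.* b)))

ℤ-parity : ∀ r → (∃[ k ] r ≡ + 2 ℤ.* k) ⊎ (∃[ k ] r ≡ + 2 ℤ.* k ℤ.+ 1ℤ)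
ℤ-parity (+ n) with parity n
... | inj₁ (m , ≡.refl) = inj₁ (+ m , pos-dbl m)
... | inj₂ (m , ≡.refl) = inj₂ (+ m , ≡.trans (≡.cong (λ z → 1ℤ ℤ.+ z) (pos-dbl m)) (ℤₚ.+-comm 1ℤ (+ 2 ℤ.* + m)))
ℤ-parity -[1+ n ] with parity n
... | inj₁ (m , ≡.refl) = inj₂ (-[1+ m ] , ≡.trans (≡.cong (λ z → ℤ.- (1ℤ ℤ.+ z)) (pos-dbl m)) (identity (+ m)))
  where
  identity : ∀ a → ℤ.- (1ℤ ℤ.+ + 2 ℤ.* a) ≡ + 2 ℤ.* (ℤ.- (1ℤ ℤ.+ a)) ℤ.+ 1ℤ
  identity = solve-∀
... | inj₂ (m , ≡.refl) = inj₁ (-[1+ m ] , ≡.trans (≡.cong (λ z → ℤ.- (+ 2 ℤ.+ z)) (pos-dbl m)) (identity (+ m)))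
  where
  identity : ∀ a → ℤ.- (+ 2 ℤ.+ + 2 ℤ.* a) ≡ + 2 ℤ.* (ℤ.- (1ℤ ℤ.+ a))
  identity = solve-∀

nonneg⇒pos : ∀ {z} → 0ℤ ℤ.≤ z → ∃[ n ] z ≡ + n
nonneg⇒pos {+ n} _ = n , ≡.refl

module Regions {c ℓ₁ ℓ₂ : Level} (K : HeytingField c ℓ₁ ℓ₂) (char0 : CharacteristicZero K) where

  open OverField K char0
  open CommutativeRing commutativeRing
  open SeriesRing commutativeRing
  open Parts commutativeRing
  open Fixed commutativeRing
  open Bernoulli K char0
  open Translation K char0
  open RingProperties ring
  open SetoidReasoning setoid

  ∑ℤ-Σ< : ∀ a b m f → b ℤ.- a ≡ + m → ∑ℤ a b f ≈ Σ< (suc m) λ j → f (a ℤ.+ + j)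
  ∑ℤ-Σ< a b m f b-a≡m with b ℤ.- a
  ∑ℤ-Σ< a b m f ≡.refl | .(+ m) = refl

  ∑ℤ-cong : ∀ a b (f g : ℤ → Carrier) → (∀ i → f i ≈ g i) → ∑ℤ a b f ≈ ∑ℤ a b g
  ∑ℤ-cong a b f g f≈g with b ℤ.- a
  ... | + m      = Σ<-cong (suc m) λ j → f≈g (a ℤ.+ + j)
  ... | -[1+ _ ] = refl

  ≈-resp-⇔ : ∀ {x x′ y y′} → x ≈ x′ → y ≈ y′ → (x ≈ y) ⇔ (x′ ≈ y′)
  ≈-resp-⇔ x≈x′ y≈y′ = mk⇔
    (λ x≈y → trans (sym x≈x′) (trans x≈y y≈y′))
    (λ x′≈y′ → trans x≈x′ (trans x′≈y′ (sym y≈y′)))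

  starTerm : Series → (r n i : ℤ) → Carrier
  starTerm γ r n i = binom (+ 2 ℤ.* n ℤ.+ r) (+ 2 ℤ.* i ℤ.+ r) *
    B (+ 2 ℤ.* n ℤ.- + 2 ℤ.* i) * coeff γ (+ 2 ℤ.* i ℤ.+ 1ℤ)

  starStarTerm : Series → (r n i : ℤ) → Carrier
  starStarTerm γ r n i = fromℕ 2 * recip (+ 2 ℤ.* i ℤ.+ r) *
    binom (ℤ.- (+ 2 ℤ.* i) ℤ.- r) (ℤ.- (+ 2 ℤ.* n) ℤ.- r) *
    B (+ 2 ℤ.* n ℤ.- + 2 ℤ.* i) * coeff γ (+ 2 ℤ.* i ℤ.+ 1ℤ)

  -- The substitution n = m - k, i = j - k eliminates `k` from the arguments of the reciprocal, the
  -- binomials and B; they become naturals, so the absolute values in `binom` and `B` act as the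
  -- identity.
  Star-Sum : ∀ γ r k n ε q m → r ≡ + 2 ℤ.* k ℤ.+ + ε → n ≡ + m ℤ.- k → suc q ≡ ε ℕ.+ dbl m →
    Star γ r k n ⇔
    (coeff γ (+ (ε ℕ.+ dbl m) ℤ.- r) ≈ StarSum ε q m (λ j → coeff γ (+ (ε ℕ.+ suc (dbl j)) ℤ.- r)))
  Star-Sum γ r k n ε q m ≡.refl ≡.refl 1+q≡ =
    ≈-resp-⇔ (reflexive (≡.cong (coeff γ) 2n≡))
      (*-cong (*-congˡ (reflexive (≡.cong recip 2n+r≡1+q)))
        (trans (∑ℤ-Σ< (ℤ.- k) n m (starTerm γ r n) (n--k≡m (+ m) k))
          (Σ<-cong-< (suc m) λ { j (s≤s j≤m) → *-cong
            (*-cong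
              (reflexive (≡.cong₂ (λ a b → fromℕ (∣ a ∣ C ∣ b ∣)) 2n+r≡1+q (2i+r≡ j)))
              (reflexive (≡.cong (λ z → bernoulli ∣ z ∣) (2n-2i≡ j j≤m))))
            (reflexive (≡.cong (coeff γ) (2i+1≡ j))) })))
    where
    pos : ∀ a j → + (a ℕ.+ dbl j) ≡ + a ℤ.+ + 2 ℤ.* + j
    pos a j = ≡.trans (ℤₚ.pos-+ a (dbl j)) (≡.cong (λ z → + a ℤ.+ z) (pos-dbl j))
    n--k≡m : ∀ m k → m ℤ.- k ℤ.- (ℤ.- k) ≡ m
    n--k≡m = solve-∀
    2n≡ : + 2 ℤ.* (+ m ℤ.- k) ≡ + (ε ℕ.+ dbl m) ℤ.- r
    2n≡ = ≡.trans (identity (+ ε) (+ m) k) (≡.cong (ℤ._- r) (≡.sym (pos ε m)))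
      where
      identity : ∀ e m k → + 2 ℤ.* (m ℤ.- k) ≡ e ℤ.+ + 2 ℤ.* m ℤ.- (+ 2 ℤ.* k ℤ.+ e)
      identity = solve-∀
    2n+r≡1+q : + 2 ℤ.* (+ m ℤ.- k) ℤ.+ r ≡ + suc q
    2n+r≡1+q = ≡.trans (identity (+ ε) (+ m) k) (≡.trans (≡.sym (pos ε m)) (≡.cong +_ (≡.sym 1+q≡)))
      where
      identity : ∀ e m k → + 2 ℤ.* (m ℤ.- k) ℤ.+ (+ 2 ℤ.* k ℤ.+ e) ≡ e ℤ.+ + 2 ℤ.* m
      identity = solve-∀
    2i+r≡ : ∀ j → + 2 ℤ.* (ℤ.- k ℤ.+ + j) ℤ.+ r ≡ + (ε ℕ.+ dbl j)
    2i+r≡ j = ≡.trans (identity (+ ε) (+ j) k) (≡.sym (pos ε j))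
      where
      identity : ∀ e j k → + 2 ℤ.* (ℤ.- k ℤ.+ j) ℤ.+ (+ 2 ℤ.* k ℤ.+ e) ≡ e ℤ.+ + 2 ℤ.* j
      identity = solve-∀
    2n-2i≡ : ∀ j → j ℕ.≤ m → + 2 ℤ.* (+ m ℤ.- k) ℤ.- + 2 ℤ.* (ℤ.- k ℤ.+ + j) ≡ + dbl (m ∸ j)
    2n-2i≡ j j≤m = ≡.trans (identity (+ m) (+ j) k)
      (≡.trans (≡.cong (ℤ._*_ (+ 2)) (≡.sym (pos-∸ j≤m))) (≡.sym (pos-dbl (m ∸ j))))
      where
      identity : ∀ m j k → + 2 ℤ.* (m ℤ.- k) ℤ.- + 2 ℤ.* (ℤ.- k ℤ.+ j) ≡ + 2 ℤ.* (m ℤ.- j)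
      identity = solve-∀
    2i+1≡ : ∀ j → + 2 ℤ.* (ℤ.- k ℤ.+ + j) ℤ.+ 1ℤ ≡ + (ε ℕ.+ suc (dbl j)) ℤ.- r
    2i+1≡ j = ≡.trans (identity (+ ε) (+ j) k)
      (≡.cong (ℤ._- r) (≡.sym (≡.trans (≡.cong +_ (ℕₚ.+-suc ε (dbl j))) (≡.cong (λ z → 1ℤ ℤ.+ z) (pos ε j)))))
      where
      identity : ∀ e j k → + 2 ℤ.* (ℤ.- k ℤ.+ j) ℤ.+ 1ℤ ≡ 1ℤ ℤ.+ (e ℤ.+ + 2 ℤ.* j) ℤ.- (+ 2 ℤ.* k ℤ.+ e)
      identity = solve-∀

  StarStar-Sum : ∀ γ s m → suc (dbl m) ℕ.≤ s →
    StarStar γ (ℤ.- + s) (+ m) ⇔ (γ (dbl m) ≈ StarStarSum γ s m)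
  StarStar-Sum γ s m 2m<s =
    ≈-resp-⇔ (reflexive (≡.cong (coeff γ) (≡.sym (pos-dbl m))))
      (trans (∑ℤ-Σ< 0ℤ (+ m) m (starStarTerm γ (ℤ.- + s) (+ m)) (ℤₚ.+-identityʳ (+ m)))
        (Σ<-cong-< (suc m) λ { j (s≤s j≤m) → *-cong (*-cong (*-cong
            (*-congˡ {fromℕ 2} (reflexive (≡.cong recip (2i+r≡ j (2j<s j j≤m)))))
            (reflexive (≡.cong₂ (λ a b → fromℕ (∣ a ∣ C ∣ b ∣)) (-2i-r≡ j (2j<s j j≤m)) -2m-r≡)))
            (reflexive (≡.cong (λ z → bernoulli ∣ z ∣) (2m-2i≡ j j≤m))))
            (reflexive (≡.cong (coeff γ) (2i+1≡ j))) }))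
    where
    2j<s : ∀ j → j ℕ.≤ m → suc (dbl j) ℕ.≤ s
    2j<s j j≤m = ℕₚ.≤-trans (s≤s (dbl-mono-≤ j≤m)) 2m<s
    s-2j-1≡ : ∀ j → suc (dbl j) ℕ.≤ s → + (s ∸ suc (dbl j)) ≡ + s ℤ.- (1ℤ ℤ.+ + 2 ℤ.* + j)
    s-2j-1≡ j 2j<s = ≡.trans (pos-∸ 2j<s) (≡.cong (λ z → + s ℤ.- (1ℤ ℤ.+ z)) (pos-dbl j))
    2i+r≡ : ∀ j → suc (dbl j) ℕ.≤ s → + 2 ℤ.* + j ℤ.+ (ℤ.- + s) ≡ -[1+ s ∸ suc (dbl j) ]
    2i+r≡ j 2j<s = ≡.trans (identity (+ s) (+ j)) (≡.cong (λ z → ℤ.- (1ℤ ℤ.+ z)) (≡.sym (s-2j-1≡ j 2j<s)))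
      where
      identity : ∀ s j → + 2 ℤ.* j ℤ.+ (ℤ.- s) ≡ ℤ.- (1ℤ ℤ.+ (s ℤ.- (1ℤ ℤ.+ + 2 ℤ.* j)))
      identity = solve-∀
    -2i-r≡ : ∀ j → suc (dbl j) ℕ.≤ s → ℤ.- (+ 2 ℤ.* + j) ℤ.- (ℤ.- + s) ≡ + suc (s ∸ suc (dbl j))
    -2i-r≡ j 2j<s = ≡.trans (identity (+ s) (+ j)) (≡.cong (λ z → 1ℤ ℤ.+ z) (≡.sym (s-2j-1≡ j 2j<s)))
      where
      identity : ∀ s j → ℤ.- (+ 2 ℤ.* j) ℤ.- (ℤ.- s) ≡ 1ℤ ℤ.+ (s ℤ.- (1ℤ ℤ.+ + 2 ℤ.* j))
      identity = solve-∀
    -2m-r≡ : ℤ.- (+ 2 ℤ.* + m) ℤ.- (ℤ.- + s) ≡ + (s ∸ dbl m)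
    -2m-r≡ = ≡.trans (identity (+ s) (+ 2 ℤ.* + m))
      (≡.trans (≡.cong (λ z → + s ℤ.- z) (≡.sym (pos-dbl m))) (≡.sym (pos-∸ (ℕₚ.<⇒≤ 2m<s))))
      where
      identity : ∀ s a → ℤ.- a ℤ.- (ℤ.- s) ≡ s ℤ.- a
      identity = solve-∀
    2m-2i≡ : ∀ j → j ℕ.≤ m → + 2 ℤ.* + m ℤ.- + 2 ℤ.* + j ≡ + dbl (m ∸ j)
    2m-2i≡ j j≤m = ≡.trans (identity (+ m) (+ j))
      (≡.trans (≡.cong (ℤ._*_ (+ 2)) (≡.sym (pos-∸ j≤m))) (≡.sym (pos-dbl (m ∸ j))))
      where
      identity : ∀ m j → + 2 ℤ.* m ℤ.- + 2 ℤ.* j ≡ + 2 ℤ.* (m ℤ.- j)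
      identity = solve-∀
    2i+1≡ : ∀ j → + 2 ℤ.* + j ℤ.+ 1ℤ ≡ + suc (dbl j)
    2i+1≡ j = ≡.trans (ℤₚ.+-comm (+ 2 ℤ.* + j) 1ℤ) (≡.cong (λ z → 1ℤ ℤ.+ z) (≡.sym (pos-dbl j)))

  upperEGF-zero : ∀ γ r a {z} → z ℤ.< 0ℤ → + suc a ℤ.- r ℤ.≤ z → upperEGF γ r a ≈ 0#
  upperEGF-zero γ r a z<0 i≤z = trans (*-congʳ (coeff-neg γ (ℤₚ.≤-<-trans i≤z z<0))) (zeroˡ (exp a))

  exp*ᵒ-zero : ∀ G p → (∀ a → a ℕ.≤ p → G a ≈ 0#) → (exp *ₛ G ᵒ) p ≈ 0#
  exp*ᵒ-zero G p G≈0 = Σ<-zero (suc p) λ d _ →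
    trans (*-congˡ (trans (*-congˡ {sgn (p ∸ d)} (G≈0 (p ∸ d) (ℕₚ.m∸n≤m p d))) (zeroʳ _))) (zeroʳ (exp d))

  -- Covers the values of `m` for which (∗) has no instance because n would be negative: all
  -- coefficients involved then lie at negative degrees.
  OddDeterminesEven-zero : ∀ G m → (∀ a → a ℕ.≤ suc (dbl m) → G a ≈ 0#) → OddDeterminesEven G m
  OddDeterminesEven-zero G m G≈0 = trans (G≈0 (dbl m) (ℕₚ.n≤1+n (dbl m)))
    (sym (Σ<-zero (suc m) λ { j (s≤s j≤m) →
      trans (*-congʳ {fromℕ 2 * inverse [exp-1]/t 1# (dbl (m ∸ j))} (G≈0 (suc (dbl j)) (s≤s (dbl-mono-≤ j≤m)))) (zeroˡ _) }))

  -- The recurrence is indexed by degrees n ≥ 0, the functional equation by indices p ≥ 0, and p = n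
  -- + r - 1 need not be a bijection between them. The sign (-1)^(n+p) depends only on the parity of
  -- r and is passed as σ.
  upper-equation : ∀ γ r σ → (∀ n p → + n ℤ.+ r ≡ + suc p → sgn (n ℕ.+ p) ≈ σ) →
    (∀ n p → + n ℤ.+ r ≡ + suc p → FixedAt γ r n) ⇔
    (∀ p → upperEGF γ r p ≈ σ * (exp *ₛ upperEGF γ r ᵒ) p)
  upper-equation γ r σ sgn≈σ = mk⇔ to from
    where
    cancel : ∀ a r → a ℤ.- r ℤ.+ r ≡ a
    cancel = solve-∀

    to : (∀ n p → + n ℤ.+ r ≡ + suc p → FixedAt γ r n) → ∀ p → upperEGF γ r p ≈ σ * (exp *ₛ upperEGF γ r ᵒ) p
    to fixed p = go (+ suc p ℤ.- r) ≡.refl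
      where
      go : ∀ z → z ≡ + suc p ℤ.- r → upperEGF γ r p ≈ σ * (exp *ₛ upperEGF γ r ᵒ) p
      go (+ n) eq = trans (Equivalence.to (FixedAt-upper γ r n p n+r≡1+p) (fixed n p n+r≡1+p))
                          (*-congʳ (sgn≈σ n p n+r≡1+p))
        where
        n+r≡1+p : + n ℤ.+ r ≡ + suc p
        n+r≡1+p = ≡.trans (≡.cong (ℤ._+ r) eq) (cancel (+ suc p) r)
      -- For p + 1 - r < 0 there is no degree n; every coefficient of index at most p is then zero,
      -- and so are both sides.
      go -[1+ t ] eq = trans (zeros p ℕₚ.≤-refl)
        (sym (trans (*-congˡ (exp*ᵒ-zero (upperEGF γ r) p zeros)) (zeroʳ σ)))
        where
        zeros : ∀ a → a ℕ.≤ p → upperEGF γ r a ≈ 0#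
        zeros a a≤p = upperEGF-zero γ r a { -[1+ t ] } ℤ.-<+
          (≡.subst (+ suc a ℤ.- r ℤ.≤_) (≡.sym eq) (ℤₚ.+-monoˡ-≤ (ℤ.- r) (ℤ.+≤+ (s≤s a≤p))))

    from : (∀ p → upperEGF γ r p ≈ σ * (exp *ₛ upperEGF γ r ᵒ) p) → ∀ n p → + n ℤ.+ r ≡ + suc p → FixedAt γ r n
    from equation n p n+r≡1+p = Equivalence.from (FixedAt-upper γ r n p n+r≡1+p)
      (trans (equation p) (*-congʳ (sym (sgn≈σ n p n+r≡1+p))))

  sgn-even-difference : ∀ n m k → + n ℤ.+ + 2 ℤ.* k ≡ + m → sgn (n ℕ.+ m) ≈ 1#
  sgn-even-difference n m (+ a) eq = begin
    sgn (n ℕ.+ m)                    ≡⟨ ≡.cong (λ z → sgn (n ℕ.+ z)) m≡n+2a ⟩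
    sgn (n ℕ.+ (n ℕ.+ dbl a))        ≈⟨ trans (sgn-+ n (n ℕ.+ dbl a)) (*-congˡ (sgn-+ n (dbl a))) ⟩
    sgn n * (sgn n * sgn (dbl a))    ≈⟨ *-congˡ (trans (*-congˡ (sgn-dbl a)) (*-identityʳ _)) ⟩
    sgn n * sgn n                    ≈⟨ sgn² n ⟩
    1#                               ∎
    where
    m≡n+2a : m ≡ n ℕ.+ dbl a
    m≡n+2a = ℤₚ.+-injective (≡.trans (≡.sym eq) (≡.cong (λ z → + n ℤ.+ z) (≡.sym (pos-dbl a))))
  sgn-even-difference n m k@(-[1+ a ]) eq = trans (reflexive (≡.cong sgn (ℕₚ.+-comm n m)))
    (sgn-even-difference m n (+ suc a) (≡.trans (≡.cong (ℤ._+ + 2 ℤ.* + suc a) (≡.sym eq)) (identity (+ n) (+ suc a))))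
    where
    identity : ∀ n a → n ℤ.+ + 2 ℤ.* (ℤ.- a) ℤ.+ + 2 ℤ.* a ≡ n
    identity = solve-∀

  -- Here σ = 1, and γ_(2n) sits at the even index 2n + r - 1 = 2m with m = n + k. The bound m ≥ 0
  -- means n ≥ -k, and negative n gives trivial relations; together they form max{0, -k}.
  upper-odd : ∀ γ r k → r ≡ + 2 ℤ.* k ℤ.+ 1ℤ →
    (∀ n p → + n ℤ.+ r ≡ + suc p → FixedAt γ r n) ⇔ (∀ n → 0ℤ ℤ.⊔ (ℤ.- k) ℤ.≤ n → Star γ r k n)
  upper-odd γ r k r≡2k+1 = mk⇔ to from
    where
    G : Series
    G = upperEGF γ r

    equation : (∀ n p → + n ℤ.+ r ≡ + suc p → FixedAt γ r n) ⇔ (∀ p → G p ≈ 1# * (exp *ₛ G ᵒ) p)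
    equation = upper-equation γ r 1# λ n p n+r≡1+p → sgn-even-difference n p k
      (≡.trans (identity (+ n) k) (≡.cong (ℤ._- 1ℤ) (≡.trans (≡.cong (λ z → + n ℤ.+ z) (≡.sym r≡2k+1)) n+r≡1+p)))
      where
      identity : ∀ n k → n ℤ.+ + 2 ℤ.* k ≡ n ℤ.+ (+ 2 ℤ.* k ℤ.+ 1ℤ) ℤ.- 1ℤ
      identity = solve-∀

    star : ∀ n m → n ≡ + m ℤ.- k → OddDeterminesEven G m ⇔ Star γ r k n
    star n m n≡m-k = mk⇔
      (λ od → Equivalence.from sums (Equivalence.to bern od))
      (λ st → Equivalence.from bern (Equivalence.to sums st))
      where
      sums = Star-Sum γ r k n 1 (dbl m) m r≡2k+1 n≡m-k ≡.refl
      bern = bernoulli-star 1 (dbl m) m ≡.refl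
               (coeff γ (+ suc (dbl m) ℤ.- r)) (λ j → coeff γ (+ suc (suc (dbl j)) ℤ.- r))

    to : (∀ n p → + n ℤ.+ r ≡ + suc p → FixedAt γ r n) → ∀ n → 0ℤ ℤ.⊔ (ℤ.- k) ℤ.≤ n → Star γ r k n
    to fixed n max≤n with nonneg⇒pos (ℤₚ.i≤j⇒0≤j-i (ℤₚ.i⊔j≤k⇒j≤k 0ℤ (ℤ.- k) max≤n))
    ... | m , n+k≡m = Equivalence.to (star n m (≡.trans (identity n k) (≡.cong (ℤ._- k) n+k≡m)))
      (shift⇒bernoulli G (suc (dbl m))
        (λ p _ → trans (Equivalence.to equation fixed p) (*-identityˡ _)) m ℕₚ.≤-refl)
      where
      identity : ∀ n k → n ≡ n ℤ.- (ℤ.- k) ℤ.- k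
      identity = solve-∀

    from : (∀ n → 0ℤ ℤ.⊔ (ℤ.- k) ℤ.≤ n → Star γ r k n) → ∀ n p → + n ℤ.+ r ≡ + suc p → FixedAt γ r n
    from stars = Equivalence.from equation λ p →
      trans (bernoulli⇒shift G p (λ m _ → determined m) p ℕₚ.≤-refl) (sym (*-identityˡ _))
      where
      determined : ∀ m → OddDeterminesEven G m
      determined m = go (+ m ℤ.- k) ≡.refl
        where
        go : ∀ z → z ≡ + m ℤ.- k → OddDeterminesEven G m
        go (+ n) eq = Equivalence.from (star (+ n) m eq) (stars (+ n) (ℤₚ.⊔-lub (ℤ.+≤+ z≤n) -k≤n))
          where
          -k≤n : ℤ.- k ℤ.≤ + n
          -k≤n = ≡.subst₂ ℤ._≤_ (ℤₚ.+-identityˡ (ℤ.- k)) (≡.sym eq) (ℤₚ.+-monoˡ-≤ (ℤ.- k) (ℤ.+≤+ (z≤n {m})))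
        -- The largest index that occurs, 2m+1, belongs to degree 2n+1, still negative for n = m - k
        -- < 0.
        go -[1+ t ] eq = OddDeterminesEven-zero G m λ a a≤2m+1 →
          upperEGF-zero γ r a (2n+1<0 t)
            (≡.subst (+ suc a ℤ.- r ℤ.≤_) top (ℤₚ.+-monoˡ-≤ (ℤ.- r) (ℤ.+≤+ (s≤s a≤2m+1))))
          where
          identity : ∀ m k → + 2 ℤ.+ + 2 ℤ.* m ℤ.- (+ 2 ℤ.* k ℤ.+ 1ℤ) ≡ + 2 ℤ.* (m ℤ.- k) ℤ.+ 1ℤ
          identity = solve-∀
          top : + suc (suc (dbl m)) ℤ.- r ≡ + 2 ℤ.* -[1+ t ] ℤ.+ 1ℤ
          top = ≡.trans (≡.cong₂ (λ a b → + 2 ℤ.+ a ℤ.- b) (pos-dbl m) r≡2k+1)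
            (≡.trans (identity (+ m) k) (≡.cong (λ z → + 2 ℤ.* z ℤ.+ 1ℤ) (≡.sym eq)))

  -- Multiplication by t, by cases instead of `X *ₛ G` so that its coefficients reduce.
  shiftX : Series → Series
  shiftX G zero    = 0#
  shiftX G (suc n) = G n

  shiftX-HalfShiftEven : ∀ G → (∀ p → G p ≈ - 1# * (exp *ₛ G ᵒ) p) ⇔ (∀ p → HalfShiftEven (shiftX G) p)
  shiftX-HalfShiftEven G = mk⇔
    (λ { odd zero    → sym (trans (+-identityʳ _) (trans (*-congˡ (zeroʳ 1#)) (zeroʳ _)))
       ; odd (suc p) → trans (odd p) (sym (step p)) })
    (λ even p → trans (even (suc p)) (step p))
    where
    step : ∀ p → (exp *ₛ shiftX G ᵒ) (suc p) ≈ - 1# * (exp *ₛ G ᵒ) p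
    step p = begin
      (exp *ₛ shiftX G ᵒ) (suc p)
        ≈⟨ *ₛ-suc exp (shiftX G ᵒ) p ⟩
      exp (suc p) * (1# * 0#) + (exp *ₛ (λ n → - sgn n * G n)) p
        ≈⟨ +-cong (trans (*-congˡ (zeroʳ 1#)) (zeroʳ _)) (S.*-congˡ {exp} (λ n → sym (-‿distribˡ-* (sgn n) (G n))) p) ⟩
      0# + (exp *ₛ (-ₛ (G ᵒ))) p
        ≈⟨ +-identityˡ _ ⟩
      (exp *ₛ (-ₛ (G ᵒ))) p
        ≈⟨ SP.-‿distribʳ-* exp (G ᵒ) p ⟨
      - (exp *ₛ G ᵒ) p
        ≈⟨ -1*x≈-x _ ⟨
      - 1# * (exp *ₛ G ᵒ) p ∎

  -- Now σ = -1, and γ_(2n) has the odd index 2n + r - 1; the factor t repairs both, giving index 2m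
  -- with m = n + k. The relations with m ≥ 1 are (∗) for n ≥ 1 - k. The one with m = 0 has the
  -- artificial coefficient 0 on its left and says that γ_(1-r) vanishes.
  upper-even : ∀ γ r k → r ≡ + 2 ℤ.* k →
    (∀ n p → + n ℤ.+ r ≡ + suc p → FixedAt γ r n) ⇔
    ((∀ n → 0ℤ ℤ.⊔ (1ℤ ℤ.- k) ℤ.≤ n → Star γ r k n) × (r ℤ.≤ 0ℤ → coeff γ (1ℤ ℤ.- r) ≈ 0#))
  upper-even γ r k r≡2k = mk⇔ to from
    where
    G : Series
    G = upperEGF γ r

    equation : (∀ n p → + n ℤ.+ r ≡ + suc p → FixedAt γ r n) ⇔ (∀ p → G p ≈ - 1# * (exp *ₛ G ᵒ) p)
    equation = upper-equation γ r (- 1#) λ n p n+r≡1+p → begin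
      sgn (n ℕ.+ p)          ≈⟨ -‿involutive _ ⟨
      - sgn (suc (n ℕ.+ p))  ≡⟨ ≡.cong (λ z → - sgn z) (≡.sym (ℕₚ.+-suc n p)) ⟩
      - sgn (n ℕ.+ suc p)    ≈⟨ -‿cong (sgn-even-difference n (suc p) k
                                  (≡.trans (≡.cong (λ z → + n ℤ.+ z) (≡.sym r≡2k)) n+r≡1+p)) ⟩
      - 1#                   ∎

    star : ∀ n m → n ≡ + suc m ℤ.- k → OddDeterminesEven (shiftX G) (suc m) ⇔ Star γ r k n
    star n m n≡m-k = mk⇔
      (λ od → Equivalence.from sums (Equivalence.to bern od))
      (λ st → Equivalence.from bern (Equivalence.to sums st))
      where
      sums = Star-Sum γ r k n 0 (suc (dbl m)) (suc m)
               (≡.trans r≡2k (≡.sym (ℤₚ.+-identityʳ (+ 2 ℤ.* k)))) n≡m-k ≡.refl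
      bern = bernoulli-star 0 (suc (dbl m)) (suc m) ≡.refl
               (coeff γ (+ suc (suc (dbl m)) ℤ.- r)) (λ j → coeff γ (+ suc (dbl j) ℤ.- r))

    to : (∀ n p → + n ℤ.+ r ≡ + suc p → FixedAt γ r n) →
         (∀ n → 0ℤ ℤ.⊔ (1ℤ ℤ.- k) ℤ.≤ n → Star γ r k n) × (r ℤ.≤ 0ℤ → coeff γ (1ℤ ℤ.- r) ≈ 0#)
    -- The constant term of G(t) = -e^t G(-t) reads G 0 = -G 0, and G 0 is γ_(1-r).
    to fixed = stars , λ _ → x≈-x⇒x≈0 _ (begin
      coeff γ (1ℤ ℤ.- r)                           ≈⟨ G0 ⟨
      G 0                                          ≈⟨ odd 0 ⟩
      - 1# * (exp 0 * (1# * G 0) + 0#)             ≈⟨ -1*x≈-x _ ⟩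
      - (exp 0 * (1# * G 0) + 0#)                  ≈⟨ -‿cong (trans (+-identityʳ _)
                                                        (trans (*-cong exp-0 (trans (*-identityˡ _) G0)) (*-identityˡ _))) ⟩
      - coeff γ (1ℤ ℤ.- r)                         ∎)
      where
      odd : ∀ p → G p ≈ - 1# * (exp *ₛ G ᵒ) p
      odd = Equivalence.to equation fixed

      G0 : G 0 ≈ coeff γ (1ℤ ℤ.- r)
      G0 = trans (*-congˡ exp-0) (*-identityʳ _)

      stars : ∀ n → 0ℤ ℤ.⊔ (1ℤ ℤ.- k) ℤ.≤ n → Star γ r k n
      stars n max≤n with nonneg⇒pos (ℤₚ.i≤j⇒0≤j-i (ℤₚ.i⊔j≤k⇒j≤k 0ℤ (1ℤ ℤ.- k) max≤n))
      ... | m , n+k-1≡m = Equivalence.to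
        (star n m (≡.trans (identity n k) (≡.cong (λ z → 1ℤ ℤ.+ z ℤ.- k) n+k-1≡m)))
        (shift⇒bernoulli (shiftX G) (suc (dbl (suc m)))
          (λ p _ → Equivalence.to (shiftX-HalfShiftEven G) odd p) (suc m) ℕₚ.≤-refl)
        where
        identity : ∀ n k → n ≡ 1ℤ ℤ.+ (n ℤ.- (1ℤ ℤ.- k)) ℤ.- k
        identity = solve-∀

    from : (∀ n → 0ℤ ℤ.⊔ (1ℤ ℤ.- k) ℤ.≤ n → Star γ r k n) × (r ℤ.≤ 0ℤ → coeff γ (1ℤ ℤ.- r) ≈ 0#) →
           ∀ n p → + n ℤ.+ r ≡ + suc p → FixedAt γ r n
    from (stars , γ[1-r]≈0) = Equivalence.from equation (Equivalence.from (shiftX-HalfShiftEven G)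
      λ p → bernoulli⇒shift (shiftX G) p (λ m _ → determined m) p ℕₚ.≤-refl)
      where
      1-r-coeff : ∀ k → r ≡ + 2 ℤ.* k → coeff γ (1ℤ ℤ.- r) ≈ 0#
      1-r-coeff (+ zero)  eq = γ[1-r]≈0 (ℤₚ.≤-reflexive eq)
      1-r-coeff -[1+ t ] eq = γ[1-r]≈0 (≡.subst (ℤ._≤ 0ℤ) (≡.sym eq) ℤ.-≤+)
      -- A positive even r is at least 2, so 1 - r is a negative degree.
      1-r-coeff +[1+ t ] eq = coeff-neg γ (≡.subst (ℤ._< 0ℤ) (≡.sym 1-r≡) (2n+1<0 t))
        where
        identity : ∀ a → 1ℤ ℤ.- + 2 ℤ.* a ≡ + 2 ℤ.* (ℤ.- a) ℤ.+ 1ℤ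
        identity = solve-∀
        1-r≡ : 1ℤ ℤ.- r ≡ + 2 ℤ.* -[1+ t ] ℤ.+ 1ℤ
        1-r≡ = ≡.trans (≡.cong (λ z → 1ℤ ℤ.- z) eq) (identity +[1+ t ])

      determined : ∀ m → OddDeterminesEven (shiftX G) m
      determined zero = sym (trans (+-identityʳ _)
        (trans (*-congʳ (trans (*-congʳ (1-r-coeff k r≡2k)) (zeroˡ _))) (zeroˡ _)))
      determined (suc m) = go (+ suc m ℤ.- k) ≡.refl
        where
        go : ∀ z → z ≡ + suc m ℤ.- k → OddDeterminesEven (shiftX G) (suc m)
        go (+ n) eq = Equivalence.from (star (+ n) m eq) (stars (+ n) (ℤₚ.⊔-lub (ℤ.+≤+ z≤n) 1-k≤n))
          where
          1-k≤n : 1ℤ ℤ.- k ℤ.≤ + n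
          1-k≤n = ≡.subst (1ℤ ℤ.- k ℤ.≤_) (≡.sym eq) (ℤₚ.+-monoˡ-≤ (ℤ.- k) (ℤ.+≤+ (s≤s (z≤n {m}))))
        go -[1+ t ] eq = OddDeterminesEven-zero (shiftX G) (suc m) λ
          { zero    _             → refl
          ; (suc a) (s≤s a≤2m) →
              upperEGF-zero γ r a (2n+1<0 t)
                (≡.subst (+ suc a ℤ.- r ℤ.≤_) top (ℤₚ.+-monoˡ-≤ (ℤ.- r) (ℤ.+≤+ (s≤s a≤2m)))) }
          where
          identity : ∀ m k → 1ℤ ℤ.+ + 2 ℤ.* m ℤ.- + 2 ℤ.* k ≡ + 2 ℤ.* (m ℤ.- k) ℤ.+ 1ℤ
          identity = solve-∀
          top : + suc (dbl (suc m)) ℤ.- r ≡ + 2 ℤ.* -[1+ t ] ℤ.+ 1ℤ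
          top = ≡.trans (≡.cong₂ (λ a b → 1ℤ ℤ.+ a ℤ.- b) (pos-dbl (suc m)) r≡2k)
            (≡.trans (identity (+ suc m) k) (≡.cong (λ z → + 2 ℤ.* z ℤ.+ 1ℤ) (≡.sym eq)))

  lower : ∀ γ s → (∀ n → n ℕ.≤ s → FixedAt γ (ℤ.- + s) n) ⇔
                  (∀ m → suc (dbl m) ℕ.≤ s → StarStar γ (ℤ.- + s) (+ m))
  lower γ s = mk⇔
    (λ fixed m 2m<s → Equivalence.from (StarStar-Sum γ s m 2m<s)
      (Equivalence.to (bernoulli-starStar γ s m 2m<s)
        (shift⇒bernoulli (lowerEGF γ s) s
          (λ n n≤s → Equivalence.to (FixedAt-lower γ s n n≤s) (fixed n n≤s)) m 2m<s)))
    (λ starStars n n≤s → Equivalence.from (FixedAt-lower γ s n n≤s)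
      (bernoulli⇒shift (lowerEGF γ s) s
        (λ m 2m<s → Equivalence.from (bernoulli-starStar γ s m 2m<s)
          (Equivalence.to (StarStar-Sum γ s m 2m<s) (starStars m 2m<s))) n n≤s))

-- The range of (∗∗).

module LowerRange {r k : ℤ} {ε s : ℕ} (ε≤1 : ε ℕ.≤ 1) (r≡2k+ε : r ≡ + 2 ℤ.* k ℤ.+ + ε) (r≡-s : r ≡ ℤ.- + s) where

  s≡ : + s ≡ ℤ.- (+ 2 ℤ.* k ℤ.+ + ε)
  s≡ = ≡.trans (≡.sym (ℤₚ.neg-involutive (+ s))) (≡.cong ℤ.-_ (≡.trans (≡.sym r≡-s) r≡2k+ε))

  -- With s = -2k - ε, the inequality 2m + 1 ≤ s is equivalent to m ≤ -k - 1 for both values of ε.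
  -- That is why (∗∗) has the same range in the even and the odd case.
  ≤-k-1⇒2m<s : ∀ m → + m ℤ.≤ ℤ.- k ℤ.- 1ℤ → suc (dbl m) ℕ.≤ s
  ≤-k-1⇒2m<s m m≤ = ℤₚ.drop‿+≤+ (begin
    1ℤ ℤ.+ + dbl m                        ≡⟨ ≡.cong (λ z → 1ℤ ℤ.+ z) (pos-dbl m) ⟩
    1ℤ ℤ.+ + 2 ℤ.* + m                    ≤⟨ ℤₚ.+-monoʳ-≤ 1ℤ (ℤₚ.*-monoˡ-≤-nonNeg (+ 2) m≤) ⟩
    1ℤ ℤ.+ + 2 ℤ.* (ℤ.- k ℤ.- 1ℤ)         ≡⟨ identity₁ k ⟩
    ℤ.- 1ℤ ℤ.+ ℤ.- (+ 2 ℤ.* k)            ≤⟨ ℤₚ.+-monoˡ-≤ (ℤ.- (+ 2 ℤ.* k)) (ℤₚ.neg-mono-≤ (ℤ.+≤+ ε≤1)) ⟩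
    ℤ.- + ε ℤ.+ ℤ.- (+ 2 ℤ.* k)           ≡⟨ identity₂ k (+ ε) ⟩
    ℤ.- (+ 2 ℤ.* k ℤ.+ + ε)               ≡⟨ s≡ ⟨
    + s                                   ∎)
    where
    open ℤₚ.≤-Reasoning
    identity₁ : ∀ k → 1ℤ ℤ.+ + 2 ℤ.* (ℤ.- k ℤ.- 1ℤ) ≡ ℤ.- 1ℤ ℤ.+ ℤ.- (+ 2 ℤ.* k)
    identity₁ = solve-∀
    identity₂ : ∀ k e → ℤ.- e ℤ.+ ℤ.- (+ 2 ℤ.* k) ≡ ℤ.- (+ 2 ℤ.* k ℤ.+ e)
    identity₂ = solve-∀

  2m<s⇒≤-k-1 : ∀ m → suc (dbl m) ℕ.≤ s → + m ℤ.≤ ℤ.- k ℤ.- 1ℤ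
  2m<s⇒≤-k-1 m 2m<s with + m ℤₚ.≤? ℤ.- k ℤ.- 1ℤ
  ... | yes m≤ = m≤
  ... | no  m≰ = contradiction s≤2m (ℕₚ.<⇒≱ 2m<s)
    where
    open ℤₚ.≤-Reasoning
    identity : ∀ k e → ℤ.- (+ 2 ℤ.* k ℤ.+ e) ≡ + 2 ℤ.* (1ℤ ℤ.+ (ℤ.- k ℤ.- 1ℤ)) ℤ.- e
    identity = solve-∀
    s≤2m : s ℕ.≤ dbl m
    s≤2m = ℤₚ.drop‿+≤+ (begin
      + s                                              ≡⟨ s≡ ⟩
      ℤ.- (+ 2 ℤ.* k ℤ.+ + ε)                          ≡⟨ identity k (+ ε) ⟩
      + 2 ℤ.* (1ℤ ℤ.+ (ℤ.- k ℤ.- 1ℤ)) ℤ.- + ε          ≤⟨ ℤₚ.i≤j⇒i-k≤j (+ ε) ℤₚ.≤-refl ⟩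
      + 2 ℤ.* (1ℤ ℤ.+ (ℤ.- k ℤ.- 1ℤ))                  ≤⟨ ℤₚ.*-monoˡ-≤-nonNeg (+ 2) (ℤₚ.i<j⇒suc[i]≤j (ℤₚ.≰⇒> m≰)) ⟩
      + 2 ℤ.* + m                                      ≡⟨ pos-dbl m ⟨
      + dbl m                                          ∎)

-- A nonempty range of (∗∗) forces k ≤ -1; this supplies the guard r < 0 in the uniqueness proofs.
nonneg≤-k-1⇒2k+ε<0 : ∀ {k n ε} → ε ℕ.≤ 1 → 0ℤ ℤ.≤ n → n ℤ.≤ ℤ.- k ℤ.- 1ℤ → + 2 ℤ.* k ℤ.+ + ε ℤ.< 0ℤ
nonneg≤-k-1⇒2k+ε<0 {k} {n} {ε} ε≤1 0≤n n≤ = begin-strict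
  + 2 ℤ.* k ℤ.+ + ε                        ≤⟨ ℤₚ.+-mono-≤ (ℤₚ.*-monoˡ-≤-nonNeg (+ 2) k≤-1) (ℤ.+≤+ ε≤1) ⟩
  + 2 ℤ.* (ℤ.- 1ℤ) ℤ.+ 1ℤ                  <⟨ ℤ.-<+ ⟩
  0ℤ                                       ∎
  where
  open ℤₚ.≤-Reasoning
  identity : ∀ k → k ℤ.+ (ℤ.- k ℤ.- 1ℤ) ≡ ℤ.- 1ℤ
  identity = solve-∀
  k≤-1 : k ℤ.≤ ℤ.- 1ℤ
  k≤-1 = begin
    k                          ≡⟨ ℤₚ.+-identityʳ k ⟨
    k ℤ.+ 0ℤ                   ≤⟨ ℤₚ.+-monoʳ-≤ k (ℤₚ.≤-trans 0≤n n≤) ⟩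
    k ℤ.+ (ℤ.- k ℤ.- 1ℤ)       ≡⟨ identity k ⟩
    ℤ.- 1ℤ                     ∎

<-k⇒≤-k-1 : ∀ {n k} → n ℤ.< ℤ.- k → n ℤ.≤ ℤ.- k ℤ.- 1ℤ
<-k⇒≤-k-1 {n} {k} n<-k = ≡.subst (n ℤ.≤_) (ℤₚ.+-comm ℤ.-1ℤ (ℤ.- k)) (ℤₚ.i<j⇒i≤pred[j] n<-k)

1-k≰-k : ∀ k → 1ℤ ℤ.- k ℤ.≤ ℤ.- k → ⊥
1-k≰-k k 1-k≤-k = ℤₚ.<-irrefl ≡.refl (ℤₚ.suc[i]≤j⇒i<j 1-k≤-k)

-k≰-k-1 : ∀ k → ℤ.- k ℤ.≤ ℤ.- k ℤ.- 1ℤ → ⊥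
-k≰-k-1 k -k≤ = ℤₚ.<-irrefl ≡.refl
  (ℤₚ.i≤pred[j]⇒i<j (≡.subst (ℤ.- k ℤ.≤_) (ℤₚ.+-comm (ℤ.- k) ℤ.-1ℤ) -k≤))

-- The equivalence, uniqueness, and the free coefficient.

module Characterisation {c ℓ₁ ℓ₂ : Level} (K : HeytingField c ℓ₁ ℓ₂) (char0 : CharacteristicZero K) where

  open OverField K char0
  open CommutativeRing commutativeRing
  open Fixed commutativeRing
  open Translation K char0
  open Regions K char0

  UpperFixed LowerFixed : Series → ℤ → Set ℓ₁
  UpperFixed γ r = ∀ n p → + n ℤ.+ r ≡ + suc p → FixedAt γ r n
  LowerFixed γ r = ∀ n s → r ≡ ℤ.- + s → n ℕ.≤ s → FixedAt γ r n

  𝓕⇔upper×lower : ∀ γ r → γ ∈𝓕 r ⇔ (UpperFixed γ r × LowerFixed γ r)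
  𝓕⇔upper×lower γ r = mk⇔
    (λ γ∈𝓕 → (λ n _ _ → 𝓕⇒FixedAt γ r γ∈𝓕 n) , (λ n _ _ _ → 𝓕⇒FixedAt γ r γ∈𝓕 n))
    (λ (up , low) → FixedAt⇒𝓕 γ r λ n → fixed up low n (+ n ℤ.+ r) ≡.refl)
    where
    cancel : ∀ a b → b ≡ a ℤ.+ b ℤ.- a
    cancel = solve-∀
    below : ∀ n j → ℤ.- + j ≡ + n ℤ.+ r → r ≡ ℤ.- + (n ℕ.+ j)
    below n j eq = ≡.trans (cancel (+ n) r)
      (≡.trans (≡.cong (ℤ._- + n) (≡.sym eq)) (≡.trans (identity (+ n) (+ j)) (≡.cong ℤ.-_ (≡.sym (ℤₚ.pos-+ n j)))))
      where
      identity : ∀ n j → ℤ.- j ℤ.- n ≡ ℤ.- (n ℤ.+ j)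
      identity = solve-∀
    fixed : UpperFixed γ r → LowerFixed γ r → ∀ n z → z ≡ + n ℤ.+ r → FixedAt γ r n
    fixed up low n +[1+ p ] eq = up n p (≡.sym eq)
    -- If n + r = -j with j ≥ 0, then s = n + j, so n ≤ s is immediate.
    fixed up low n (+ 0)    eq = low n (n ℕ.+ 0) (below n 0 eq) (ℕₚ.m≤m+n n 0)
    fixed up low n -[1+ j ] eq = low n (n ℕ.+ suc j) (below n (suc j) eq) (ℕₚ.m≤m+n n (suc j))

  LowerConditions : Series → (r k : ℤ) → Set ℓ₁
  LowerConditions γ r k = r ℤ.< 0ℤ → ∀ n → 0ℤ ℤ.≤ n → n ℤ.≤ ℤ.- k ℤ.- 1ℤ → StarStar γ r n

  lowerFixed : ∀ γ r k ε → ε ℕ.≤ 1 → r ≡ + 2 ℤ.* k ℤ.+ + ε → LowerFixed γ r ⇔ LowerConditions γ r k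
  lowerFixed γ r k ε ε≤1 r≡2k+ε = mk⇔ (to r r≡2k+ε) from
    where
    to : ∀ r → r ≡ + 2 ℤ.* k ℤ.+ + ε → LowerFixed γ r → LowerConditions γ r k
    to (+ _)    _       _   (ℤ.+<+ ())
    to -[1+ a ] r≡2k+ε low _ (+ m) _ m≤ = Equivalence.to (lower γ (suc a))
      (λ n n≤s → low n (suc a) ≡.refl n≤s) m
      (LowerRange.≤-k-1⇒2m<s {k = k} ε≤1 r≡2k+ε ≡.refl m m≤)

    from : LowerConditions γ r k → LowerFixed γ r
    from cond n s ≡.refl n≤s = Equivalence.from (lower γ s)
      -- Each required instance of (∗∗) has 2m + 1 ≤ s, hence s > 0 and r < 0. For r = 0 there is
      -- none, and the recurrence at degree 0 holds automatically.
      (λ m 2m<s → cond (ℤₚ.neg-mono-< (ℤ.+<+ (ℕₚ.≤-trans (s≤s z≤n) 2m<s))) (+ m) (ℤ.+≤+ z≤n)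
        (LowerRange.2m<s⇒≤-k-1 {k = k} ε≤1 r≡2k+ε ≡.refl m 2m<s)) n n≤s

  r≡2k+0 : ∀ {r k} → r ≡ + 2 ℤ.* k → r ≡ + 2 ℤ.* k ℤ.+ 0ℤ
  r≡2k+0 {k = k} r≡2k = ≡.trans r≡2k (≡.sym (ℤₚ.+-identityʳ (+ 2 ℤ.* k)))

  𝓕⇔EvenConditions : ∀ γ r k → r ≡ + 2 ℤ.* k → γ ∈𝓕 r ⇔ EvenConditions γ r k
  𝓕⇔EvenConditions γ r k r≡2k = mk⇔
    (λ γ∈𝓕 → let (up , low) = Equivalence.to (𝓕⇔upper×lower γ r) γ∈𝓕
                 (stars , γ[1-r]≈0) = Equivalence.to (upper-even γ r k r≡2k) up
             in stars , γ[1-r]≈0 , Equivalence.to lowers low)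
    (λ (stars , γ[1-r]≈0 , starStars) → Equivalence.from (𝓕⇔upper×lower γ r)
      (Equivalence.from (upper-even γ r k r≡2k) (stars , γ[1-r]≈0) , Equivalence.from lowers starStars))
    where
    lowers : LowerFixed γ r ⇔ LowerConditions γ r k
    lowers = lowerFixed γ r k 0 z≤n (r≡2k+0 {k = k} r≡2k)

  𝓕⇔OddConditions : ∀ γ r k → r ≡ + 2 ℤ.* k ℤ.+ 1ℤ → γ ∈𝓕 r ⇔ OddConditions γ r k
  𝓕⇔OddConditions γ r k r≡2k+1 = mk⇔
    (λ γ∈𝓕 → let (up , low) = Equivalence.to (𝓕⇔upper×lower γ r) γ∈𝓕
             in Equivalence.to (upper-odd γ r k r≡2k+1) up , Equivalence.to lowers low)
    (λ (stars , starStars) → Equivalence.from (𝓕⇔upper×lower γ r)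
      (Equivalence.from (upper-odd γ r k r≡2k+1) stars , Equivalence.from lowers starStars))
    where
    lowers : LowerFixed γ r ⇔ LowerConditions γ r k
    lowers = lowerFixed γ r k 1 (s≤s z≤n) r≡2k+1

  𝓕⇔Conditions : ∀ γ r → γ ∈𝓕 r ⇔ Conditions γ r
  𝓕⇔Conditions γ r = mk⇔
    (λ γ∈𝓕 → (λ k r≡2k → Equivalence.to (𝓕⇔EvenConditions γ r k r≡2k) γ∈𝓕)
           , (λ k r≡2k+1 → Equivalence.to (𝓕⇔OddConditions γ r k r≡2k+1) γ∈𝓕))
    (λ (even , odd) → from even odd (ℤ-parity r))
    where
    from : (∀ k → r ≡ + 2 ℤ.* k → EvenConditions γ r k) →
           (∀ k → r ≡ + 2 ℤ.* k ℤ.+ 1ℤ → OddConditions γ r k) →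
           (∃[ k ] r ≡ + 2 ℤ.* k) ⊎ (∃[ k ] r ≡ + 2 ℤ.* k ℤ.+ 1ℤ) → γ ∈𝓕 r
    from even odd (inj₁ (k , r≡2k))   = Equivalence.from (𝓕⇔EvenConditions γ r k r≡2k) (even k r≡2k)
    from even odd (inj₂ (k , r≡2k+1)) = Equivalence.from (𝓕⇔OddConditions γ r k r≡2k+1) (odd k r≡2k+1)

  module _ {γ δ : Series} (odd≈ : ∀ i → coeff γ (+ 2 ℤ.* i ℤ.+ 1ℤ) ≈ coeff δ (+ 2 ℤ.* i ℤ.+ 1ℤ)) where

    starSum-cong : ∀ r k n → fromℕ 2 * recip (+ 2 ℤ.* n ℤ.+ r) * ∑ℤ (ℤ.- k) n (starTerm γ r n) ≈
                             fromℕ 2 * recip (+ 2 ℤ.* n ℤ.+ r) * ∑ℤ (ℤ.- k) n (starTerm δ r n)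
    starSum-cong r k n = *-congˡ (∑ℤ-cong (ℤ.- k) n (starTerm γ r n) (starTerm δ r n) λ i → *-congˡ (odd≈ i))

    starStarSum-cong : ∀ r n → ∑ℤ 0ℤ n (starStarTerm γ r n) ≈ ∑ℤ 0ℤ n (starStarTerm δ r n)
    starStarSum-cong r n = ∑ℤ-cong 0ℤ n (starStarTerm γ r n) (starStarTerm δ r n) λ i → *-congˡ (odd≈ i)

    Star-unique : ∀ r k n → Star γ r k n → Star δ r k n → coeff γ (+ 2 ℤ.* n) ≈ coeff δ (+ 2 ℤ.* n)
    Star-unique r k n starγ starδ = trans starγ (trans (starSum-cong r k n) (sym starδ))

    StarStar-unique : ∀ r n → StarStar γ r n → StarStar δ r n → coeff γ (+ 2 ℤ.* n) ≈ coeff δ (+ 2 ℤ.* n)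
    StarStar-unique r n starγ starδ = trans starγ (trans (starStarSum-cong r n) (sym starδ))

    Star-resp : ∀ r k n → coeff γ (+ 2 ℤ.* n) ≈ coeff δ (+ 2 ℤ.* n) → Star γ r k n → Star δ r k n
    Star-resp r k n 2n≈ starγ = trans (sym 2n≈) (trans starγ (starSum-cong r k n))

    StarStar-resp : ∀ r n → coeff γ (+ 2 ℤ.* n) ≈ coeff δ (+ 2 ℤ.* n) → StarStar γ r n → StarStar δ r n
    StarStar-resp r n 2n≈ starγ = trans (sym 2n≈) (trans starγ (starStarSum-cong r n))

    -- The ranges n ≥ 1 - k of (∗) and n ≤ -k - 1 of (∗∗) leave out exactly n = -k, and in both the
    -- right side involves γ only at odd degrees.
    EvenConditions-unique : ∀ {r k} → r ≡ + 2 ℤ.* k → EvenConditions γ r k → EvenConditions δ r k →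
      ∀ n → 0ℤ ℤ.≤ n → n ≢ ℤ.- k → coeff γ (+ 2 ℤ.* n) ≈ coeff δ (+ 2 ℤ.* n)
    EvenConditions-unique {r} {k} r≡2k (starγ , _ , starStarγ) (starδ , _ , starStarδ) n 0≤n n≢-k
      with 1ℤ ℤ.- k ℤₚ.≤? n
    ... | yes 1-k≤n = Star-unique r k n (starγ n max≤n) (starδ n max≤n)
      where
      max≤n : 0ℤ ℤ.⊔ (1ℤ ℤ.- k) ℤ.≤ n
      max≤n = ℤₚ.⊔-lub 0≤n 1-k≤n
    ... | no 1-k≰n = StarStar-unique r n (starStarγ r<0 n 0≤n n≤) (starStarδ r<0 n 0≤n n≤)
      where
      n≤-k : n ℤ.≤ ℤ.- k
      n≤-k = ≡.subst (n ℤ.≤_) (ℤₚ.pred-suc (ℤ.- k)) (ℤₚ.i<j⇒i≤pred[j] (ℤₚ.≰⇒> 1-k≰n))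
      n≤ : n ℤ.≤ ℤ.- k ℤ.- 1ℤ
      n≤ = <-k⇒≤-k-1 (ℤₚ.≤∧≢⇒< n≤-k n≢-k)
      r<0 : r ℤ.< 0ℤ
      r<0 = ≡.subst (ℤ._< 0ℤ) (≡.sym (r≡2k+0 {k = k} r≡2k)) (nonneg≤-k-1⇒2k+ε<0 {k} z≤n 0≤n n≤)

    OddConditions-unique : ∀ {r k} → r ≡ + 2 ℤ.* k ℤ.+ 1ℤ → OddConditions γ r k → OddConditions δ r k →
      ∀ n → 0ℤ ℤ.≤ n → coeff γ (+ 2 ℤ.* n) ≈ coeff δ (+ 2 ℤ.* n)
    OddConditions-unique {r} {k} r≡2k+1 (starγ , starStarγ) (starδ , starStarδ) n 0≤n
      with ℤ.- k ℤₚ.≤? n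
    ... | yes -k≤n = Star-unique r k n (starγ n max≤n) (starδ n max≤n)
      where
      max≤n : 0ℤ ℤ.⊔ (ℤ.- k) ℤ.≤ n
      max≤n = ℤₚ.⊔-lub 0≤n -k≤n
    ... | no -k≰n = StarStar-unique r n (starStarγ r<0 n 0≤n n≤) (starStarδ r<0 n 0≤n n≤)
      where
      n≤ : n ℤ.≤ ℤ.- k ℤ.- 1ℤ
      n≤ = <-k⇒≤-k-1 (ℤₚ.≰⇒> -k≰n)
      r<0 : r ℤ.< 0ℤ
      r<0 = ≡.subst (ℤ._< 0ℤ) (≡.sym r≡2k+1) (nonneg≤-k-1⇒2k+ε<0 {k} (s≤s z≤n) 0≤n n≤)

  determined : ∀ r γ δ → Conditions γ r → Conditions δ r →
    (∀ i → γ (2 ℕ.* i ℕ.+ 1) ≈ δ (2 ℕ.* i ℕ.+ 1)) →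
    ∀ i → + (2 ℕ.* i) ≢ ℤ.- r → γ (2 ℕ.* i) ≈ δ (2 ℕ.* i)
  determined r γ δ (evenγ , oddγ) (evenδ , oddδ) odd≈ i 2i≢-r =
    trans (reflexive (≡.cong (coeff γ) (ℤₚ.pos-* 2 i)))
      (trans (go (ℤ-parity r)) (reflexive (≡.cong (coeff δ) (≡.sym (ℤₚ.pos-* 2 i)))))
    where
    odd≈ℤ : ∀ i → coeff γ (+ 2 ℤ.* i ℤ.+ 1ℤ) ≈ coeff δ (+ 2 ℤ.* i ℤ.+ 1ℤ)
    odd≈ℤ (+ i) = trans (reflexive (≡.cong (coeff γ) 2i+1≡))
      (trans (odd≈ i) (reflexive (≡.cong (coeff δ) (≡.sym 2i+1≡))))
      where
      2i+1≡ : + 2 ℤ.* + i ℤ.+ 1ℤ ≡ + (2 ℕ.* i ℕ.+ 1)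
      2i+1≡ = ≡.cong (ℤ._+ 1ℤ) (≡.sym (ℤₚ.pos-* 2 i))
    odd≈ℤ -[1+ t ] = trans (coeff-neg γ (2n+1<0 t)) (sym (coeff-neg δ (2n+1<0 t)))

    go : (∃[ k ] r ≡ + 2 ℤ.* k) ⊎ (∃[ k ] r ≡ + 2 ℤ.* k ℤ.+ 1ℤ) → coeff γ (+ 2 ℤ.* + i) ≈ coeff δ (+ 2 ℤ.* + i)
    go (inj₁ (k , r≡2k)) = EvenConditions-unique odd≈ℤ r≡2k (evenγ k r≡2k) (evenδ k r≡2k) (+ i) (ℤ.+≤+ z≤n)
      λ i≡-k → 2i≢-r (≡.trans (ℤₚ.pos-* 2 i) (≡.trans (≡.cong (ℤ._*_ (+ 2)) i≡-k)
        (≡.trans (≡.sym (ℤₚ.neg-distribʳ-* (+ 2) k)) (≡.cong ℤ.-_ (≡.sym r≡2k)))))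
    go (inj₂ (k , r≡2k+1)) = OddConditions-unique odd≈ℤ r≡2k+1 (oddγ k r≡2k+1) (oddδ k r≡2k+1) (+ i) (ℤ.+≤+ z≤n)

  -- No condition mentions γ_(-r). The degree -r = 2(-k) is even, so it is absent from all sums; the
  -- left sides skip n = -k; and 1 - r differs from -r.
  unconstrained : ∀ r → (∃[ k ] r ≡ + 2 ℤ.* k) → ∀ γ δ → (∀ m → + m ≢ ℤ.- r → γ m ≈ δ m) →
    Conditions γ r → Conditions δ r
  unconstrained r (k₀ , r≡2k₀) γ δ γ≈δ (evenγ , _) =
    even , λ k r≡2k+1 → contradiction (≡.trans (≡.sym r≡2k₀) r≡2k+1) (even≢odd k₀ k)
    where
    coeff≈ : ∀ z → z ≢ ℤ.- r → coeff γ z ≈ coeff δ z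
    coeff≈ (+ m)    z≢-r = γ≈δ m z≢-r
    coeff≈ -[1+ _ ] _    = refl

    -r≡2[-k₀] : ℤ.- r ≡ + 2 ℤ.* (ℤ.- k₀)
    -r≡2[-k₀] = ≡.trans (≡.cong ℤ.-_ r≡2k₀) (ℤₚ.neg-distribʳ-* (+ 2) k₀)

    odd≢-r : ∀ i → + 2 ℤ.* i ℤ.+ 1ℤ ≢ ℤ.- r
    odd≢-r i 2i+1≡-r = even≢odd (ℤ.- k₀) i (≡.sym (≡.trans 2i+1≡-r -r≡2[-k₀]))

    odd≈ : ∀ i → coeff γ (+ 2 ℤ.* i ℤ.+ 1ℤ) ≈ coeff δ (+ 2 ℤ.* i ℤ.+ 1ℤ)
    odd≈ i = coeff≈ (+ 2 ℤ.* i ℤ.+ 1ℤ) (odd≢-r i)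

    even : ∀ k → r ≡ + 2 ℤ.* k → EvenConditions δ r k
    even k r≡2k with evenγ k r≡2k
    ... | starγ , γ[1-r]≈0 , starStarγ =
        (λ n max≤n → Star-resp odd≈ r k n
          (2n≈ n λ { ≡.refl → 1-k≰-k k (ℤₚ.i⊔j≤k⇒j≤k 0ℤ (1ℤ ℤ.- k) max≤n) }) (starγ n max≤n))
      , (λ r≤0 → trans (sym (coeff≈ (1ℤ ℤ.- r) 1-r≢-r)) (γ[1-r]≈0 r≤0))
      , (λ r<0 n 0≤n n≤ → StarStar-resp odd≈ r n (2n≈ n λ { ≡.refl → -k≰-k-1 k n≤ }) (starStarγ r<0 n 0≤n n≤))
      where
      2n≈ : ∀ n → n ≢ ℤ.- k → coeff γ (+ 2 ℤ.* n) ≈ coeff δ (+ 2 ℤ.* n)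
      2n≈ n n≢-k = coeff≈ (+ 2 ℤ.* n) λ 2n≡-r → n≢-k (ℤₚ.*-cancelˡ-≡ (+ 2) n (ℤ.- k)
        (≡.trans 2n≡-r (≡.trans (≡.cong ℤ.-_ r≡2k) (ℤₚ.neg-distribʳ-* (+ 2) k))))
      1-r≢-r : 1ℤ ℤ.- r ≢ ℤ.- r
      1-r≢-r 1-r≡-r = 1-k≰-k r (ℤₚ.≤-reflexive 1-r≡-r)

theorem5p9 : ∀ {c ℓ₁ ℓ₂} (K : HeytingField c ℓ₁ ℓ₂) (char0 : CharacteristicZero K) →
    let open HeytingField K using (_≈_)
        open OverField K char0 in
    (r : ℤ) →
      ((γ : Series) → γ ∈𝓕 r ⇔ Conditions γ r) ×
      ((γ δ : Series) → Conditions γ r → Conditions δ r →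
        (∀ i → γ (2 ℕ.* i ℕ.+ 1) ≈ δ (2 ℕ.* i ℕ.+ 1)) →
        ∀ i → + (2 ℕ.* i) ≢ ℤ.- r → γ (2 ℕ.* i) ≈ δ (2 ℕ.* i)) ×
      (r ℤ.≤ 0ℤ → (∃[ k ] r ≡ + 2 ℤ.* k) →
        (γ δ : Series) → (∀ m → + m ≢ ℤ.- r → γ m ≈ δ m) →
        Conditions γ r → Conditions δ r)
theorem5p9 K char0 r =
  (λ γ → 𝓕⇔Conditions γ r) , determined r , λ _ r-even → unconstrained r r-even
  where open Characterisation K char0
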